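{- Let $V$ be a finite set (case $q=1$) or a finite-dimensional $\mathbb{F}_q$-vector space (case $q\ge 2$ a prime power), $n=\operatorname{rk}V$. Let $k\in\{0,\ldots,n\}$ and let $I\le J\le V$ be subspaces with $i=\operatorname{rk}I$ and $j=n-\operatorname{rk}J$. Let $\mathcal{F}^{(V,k)}(I,J)=\{K\in{V\brack k}\mid I\le K\le J\}$. Then $$\deg\mathcal{F}^{(V,k)}(I,J)=\begin{cases}-\infty&\text{if }i>k\text{ or }j>n-k,\\ \min(i+j,\,k,\,n-k)&\text{otherwise.}\end{cases}$$
   Context: For $q=1$, "subspaces" of $V$ are subsets and $\operatorname{rk}U=\#U$; for $q\ge2$ they are $\mathbb{F}_q$-linear subspaces and $\operatorname{rk}U=\dim U$. $U\le W$ means inclusion. ${V\brack k}$ is the set of all subspaces of $V$ of rank $k$. For a subspace $U$ of $V$, $\boldsymbol{x}_U^{(k)}$ is the characteristic function of $\{K\in{V\brack k}\mid U\le K\}$. For $i\in\{0,\ldots,\min(k,n-k)\}$, $\bar V_i^{(k)}\subseteq\mathbb{R}^{{V\brack k}}$ is the real span of $\{\boldsymbol{x}_I^{(k)}\mid I\in{V\brack i}\}$; these spaces form an increasing chain with $\bar V^{(k)}_{\min(k,n-k)}=\mathbb{R}^{{V\brack k}}$. The degree of a non-zero $f:{V\brack k}\to\mathbb{R}$ is the smallest $t\in\{0,\ldots,\min(k,n-k)\}$ with $f\in\bar V_t^{(k)}$; $\deg(\boldsymbol 0)=-\infty$. The degree of a set $\mathcal{F}\subseteq{V\brack k}$ is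 the degree of its characteristic function. -}

module Defs where

open import Level using (0ℓ)
open import Data.Bool.Base using (Bool; true; if_then_else_; T)
open import Data.Empty using (⊥-elim)
open import Data.Fin.Base using (Fin; finToFun; funToFin)
open import Data.Fin.Properties using (all?; finToFun-funToFin)
open import Data.List.Base using (List; map; foldr)
open import Data.Nat.Base as ℕ using (ℕ; _∸_; _⊓_)
import Data.Nat.Properties as ℕ
open import Data.Product.Base using (Σ; ∃; _×_; _,_; proj₁; proj₂)
open import Data.Rational.Base as ℚ using (ℚ; 0ℚ; 1ℚ; ½)
import Data.Rational.Properties as ℚ
open import Data.Unit.Base using (tt)
open import Function.Base using (const; _∘_)
open import Function.Bundles using (Inverse; _↔_)
open import Relation.Binary.Core using (Rel)
import Relation.Binary.Definitions as Binary
open import Relation.Binary.PropositionalEquality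
  using (_≡_; refl; sym; trans; cong; cong₂; subst; setoid)
open import Relation.Nullary.Construct.Add.Infimum using (_₋; ⊥₋; [_])
open import Relation.Nullary.Decidable
  using (Dec; does; map′; T?; _→-dec_; _×-dec_)
open import Relation.Nullary.Negation using (¬_)
open import Relation.Unary using (Pred; Decidable)
open import Algebra.Apartness.Bundles using (HeytingField; HeytingCommutativeRing)
open import Algebra.Bundles using (CommutativeRing)
open import Algebra.Module.Bundles using (Module)
import Algebra.Properties.Monoid.Sum as MonoidSum

------------------------------------------------------------------------
-- The real numbers: Cauchy sequences of rationals, where two sequences
-- are identified (by _≃_) when their difference tends to zero.

dist : ℚ → ℚ → ℚ
dist p q = ℚ.∣ p ℚ.- q ∣

IsCauchy : (ℕ → ℚ) → Set
IsCauchy s = ∀ ε → 0ℚ ℚ.< ε →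
  ∃ λ N → ∀ m n → N ℕ.≤ m → N ℕ.≤ n → dist (s m) (s n) ℚ.≤ ε

record ℝ : Set where
  constructor mkℝ
  field
    seq    : ℕ → ℚ
    cauchy : IsCauchy seq

open ℝ public

infix 4 _≃_

_≃_ : Rel ℝ 0ℓ
x ≃ y = ∀ ε → 0ℚ ℚ.< ε →
  ∃ λ N → ∀ n → N ℕ.≤ n → dist (seq x n) (seq y n) ℚ.≤ ε

fromℚ : ℚ → ℝ
fromℚ p = mkℝ (const p) λ ε 0<ε → 0 , λ _ _ _ _ →
  subst (ℚ._≤ ε) (sym (cong ℚ.∣_∣ (ℚ.+-inverseʳ p))) (ℚ.<⇒≤ 0<ε)

0ℝ 1ℝ : ℝ
0ℝ = fromℚ 0ℚ
1ℝ = fromℚ 1ℚ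

private
  open import Data.Rational.Solver using (module +-*-Solver)
  open +-*-Solver using (solve; _:=_; _:+_; _:*_; _:-_)

  dist-+ : ∀ a b c d → dist (a ℚ.+ b) (c ℚ.+ d) ℚ.≤ dist a c ℚ.+ dist b d
  dist-+ a b c d = subst (λ z → ℚ.∣ z ∣ ℚ.≤ dist a c ℚ.+ dist b d)
    (solve 4 (λ a b c d →
      (a :- c) :+ (b :- d) := (a :+ b) :- (c :+ d)) refl a b c d)
    (ℚ.∣p+q∣≤∣p∣+∣q∣ (a ℚ.- c) (b ℚ.- d))

  dist-* : ∀ a b c d →
    dist (a ℚ.* b) (c ℚ.* d) ℚ.≤ ℚ.∣ a ∣ ℚ.* dist b d ℚ.+ ℚ.∣ d ∣ ℚ.* dist a c
  dist-* a b c d = begin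
    ℚ.∣ a ℚ.* b ℚ.- c ℚ.* d ∣
      ≡⟨ cong ℚ.∣_∣ (solve 4 (λ a b c d →
           a :* b :- c :* d := a :* (b :- d) :+ d :* (a :- c)) refl a b c d) ⟩
    ℚ.∣ a ℚ.* (b ℚ.- d) ℚ.+ d ℚ.* (a ℚ.- c) ∣
      ≤⟨ ℚ.∣p+q∣≤∣p∣+∣q∣ (a ℚ.* (b ℚ.- d)) (d ℚ.* (a ℚ.- c)) ⟩
    ℚ.∣ a ℚ.* (b ℚ.- d) ∣ ℚ.+ ℚ.∣ d ℚ.* (a ℚ.- c) ∣
      ≡⟨ cong₂ ℚ._+_ (ℚ.∣p*q∣≡∣p∣*∣q∣ a (b ℚ.- d)) (ℚ.∣p*q∣≡∣p∣*∣q∣ d (a ℚ.- c)) ⟩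
    ℚ.∣ a ∣ ℚ.* dist b d ℚ.+ ℚ.∣ d ∣ ℚ.* dist a c ∎
    where open ℚ.≤-Reasoning

  half-pos : ∀ {ε} → 0ℚ ℚ.< ε → 0ℚ ℚ.< ½ ℚ.* ε
  half-pos {ε} 0<ε = ℚ.positive⁻¹ (½ ℚ.* ε)
    where instance
      _ = ℚ.positive 0<ε
      _ = ℚ.pos*pos⇒pos ½ ε

  halves : ∀ ε → ½ ℚ.* ε ℚ.+ ½ ℚ.* ε ≡ ε
  halves ε = trans (sym (ℚ.*-distribʳ-+ ε ½ ½)) (ℚ.*-identityˡ ε)

  bound : ∀ s → IsCauchy s → ∃ λ N → Σ ℚ λ B →
    ℚ.Positive B × (∀ n → N ℕ.≤ n → ℚ.∣ s n ∣ ℚ.≤ B)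
  bound s c = N , B , ℚ.positive 0<B , λ n N≤n → begin
      ℚ.∣ s n ∣
        ≡⟨ cong ℚ.∣_∣ (solve 2 (λ a b → a := (a :- b) :+ b) refl (s n) (s N)) ⟩
      ℚ.∣ (s n ℚ.- s N) ℚ.+ s N ∣  ≤⟨ ℚ.∣p+q∣≤∣p∣+∣q∣ (s n ℚ.- s N) (s N) ⟩
      dist (s n) (s N) ℚ.+ ℚ.∣ s N ∣
        ≤⟨ ℚ.+-monoˡ-≤ ℚ.∣ s N ∣ (proj₂ (c 1ℚ 0<1) n N N≤n ℕ.≤-refl) ⟩
      B ∎
    where
    open ℚ.≤-Reasoning
    0<1 : 0ℚ ℚ.< 1ℚ
    0<1 = ℚ.positive⁻¹ 1ℚ
    N = proj₁ (c 1ℚ 0<1)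
    B = 1ℚ ℚ.+ ℚ.∣ s N ∣
    0<B : 0ℚ ℚ.< B
    0<B = ℚ.+-mono-<-≤ 0<1 (ℚ.0≤∣p∣ (s N))

  scaled : ∀ {ε} B → ℚ.Positive B → 0ℚ ℚ.< ε →
    Σ ℚ λ δ → (0ℚ ℚ.< δ) × (B ℚ.* δ ≡ ε)
  scaled {ε} B posB 0<ε = ℚ.1/ B ℚ.* ε , ℚ.positive⁻¹ (ℚ.1/ B ℚ.* ε) ,
    trans (sym (ℚ.*-assoc B (ℚ.1/ B) ε))
      (trans (cong (ℚ._* ε) (ℚ.*-inverseʳ B)) (ℚ.*-identityˡ ε))
    where instance
      _ = posB
      _ = ℚ.pos⇒nonZero B
      _ = ℚ.positive 0<ε
      _ = ℚ.1/pos⇒pos B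
      _ = ℚ.pos*pos⇒pos (ℚ.1/ B) ε

  *-bound : ∀ {p q B δ} → ℚ.Positive B → p ℚ.≤ B → 0ℚ ℚ.≤ q → q ℚ.≤ δ →
    p ℚ.* q ℚ.≤ B ℚ.* δ
  *-bound {p} {q} {B} {δ} posB p≤B 0≤q q≤δ = ℚ.≤-trans
    (ℚ.*-monoʳ-≤-nonNeg q p≤B) (ℚ.*-monoˡ-≤-nonNeg B q≤δ)
    where instance
      _ = posB
      _ = ℚ.pos⇒nonNeg B
      _ = ℚ.nonNegative 0≤q

infixl 6 _+ℝ_
infixl 7 _*ℝ_

_+ℝ_ : ℝ → ℝ → ℝ
mkℝ s cs +ℝ mkℝ t ct = mkℝ (λ n → s n ℚ.+ t n) λ ε 0<ε →
  let (M , close-s) = cs (½ ℚ.* ε) (half-pos 0<ε)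
      (N , close-t) = ct (½ ℚ.* ε) (half-pos 0<ε)
  in M ℕ.⊔ N , λ m n m≥ n≥ → ℚ.≤-trans
       (dist-+ (s m) (t m) (s n) (t n))
       (subst (dist (s m) (s n) ℚ.+ dist (t m) (t n) ℚ.≤_) (halves ε)
         (ℚ.+-mono-≤
           (close-s m n (ℕ.m⊔n≤o⇒m≤o M N m≥) (ℕ.m⊔n≤o⇒m≤o M N n≥))
           (close-t m n (ℕ.m⊔n≤o⇒n≤o M N m≥) (ℕ.m⊔n≤o⇒n≤o M N n≥))))

_*ℝ_ : ℝ → ℝ → ℝ
mkℝ s cs *ℝ mkℝ t ct = mkℝ (λ n → s n ℚ.* t n) λ ε 0<ε →
  let (M₁ , B , posB , s≤B) = bound s cs
      (N₁ , C , posC , t≤C) = bound t ct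
      (β , 0<β , Bβ≡) = scaled B posB (half-pos 0<ε)
      (γ , 0<γ , Cγ≡) = scaled C posC (half-pos 0<ε)
      (M₂ , close-s) = cs γ 0<γ
      (N₂ , close-t) = ct β 0<β
      M = M₁ ℕ.⊔ M₂
      N = N₁ ℕ.⊔ N₂
      toM : ∀ {o} → M ℕ.⊔ N ℕ.≤ o → M ℕ.≤ o
      toM = ℕ.m⊔n≤o⇒m≤o M N
      toN : ∀ {o} → M ℕ.⊔ N ℕ.≤ o → N ℕ.≤ o
      toN = ℕ.m⊔n≤o⇒n≤o M N
  in M ℕ.⊔ N , λ m n m≥ n≥ → ℚ.≤-trans
       (dist-* (s m) (t m) (s n) (t n))
       (subst (ℚ.∣ s m ∣ ℚ.* dist (t m) (t n) ℚ.+ ℚ.∣ t n ∣ ℚ.* dist (s m) (s n) ℚ.≤_)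
         (trans (cong₂ ℚ._+_ Bβ≡ Cγ≡) (halves ε))
         (ℚ.+-mono-≤
           (*-bound posB (s≤B m (ℕ.m⊔n≤o⇒m≤o M₁ M₂ (toM m≥)))
             (ℚ.0≤∣p∣ (t m ℚ.- t n))
             (close-t m n (ℕ.m⊔n≤o⇒n≤o N₁ N₂ (toN m≥)) (ℕ.m⊔n≤o⇒n≤o N₁ N₂ (toN n≥))))
           (*-bound posC (t≤C n (ℕ.m⊔n≤o⇒m≤o N₁ N₂ (toN n≥)))
             (ℚ.0≤∣p∣ (s m ℚ.- s n))
             (close-s m n (ℕ.m⊔n≤o⇒n≤o M₁ M₂ (toM m≥)) (ℕ.m⊔n≤o⇒n≤o M₁ M₂ (toM n≥))))))

sumℝ : List ℝ → ℝ
sumℝ = foldr _+ℝ_ 0ℝ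

------------------------------------------------------------------------
-- What subset lattices (q = 1) and subspace lattices (q ≥ 2) have in
-- common.  Subspaces U, W are regarded as equal when U ≼ W and W ≼ U.

record Geometry : Set₁ where
  infix 4 _≼_ _≼?_
  field
    Sub     : Set
    _≼_     : Rel Sub 0ℓ
    _≼?_    : Binary.Decidable _≼_
    HasRank : Sub → ℕ → Set
    rkV     : ℕ

-- Subsets and subspaces are Bool-valued characteristic maps: membership
-- has to be decidable for x_U^(k) to be a function.

module FiniteSet (A : Set) (n : ℕ) (A↔Fin : A ↔ Fin n) where

  Subset : Set
  Subset = A → Bool

  _⊆_ : Rel Subset 0ℓ
  U ⊆ W = ∀ a → T (U a) → T (W a)

  HasSize : Subset → ℕ → Set
  HasSize U r = (∃ λ a → T (U a)) ↔ Fin r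

  open Inverse A↔Fin using (to; from; strictlyInverseʳ)

  _⊆?_ : Binary.Decidable _⊆_
  U ⊆? W = map′
    (λ h a → subst (λ b → T (U b) → T (W b)) (strictlyInverseʳ a) (h (to a)))
    (λ h i → h (from i))
    (all? λ i → T? (U (from i)) →-dec T? (W (from i)))

  subsets : Geometry
  subsets = record
    { Sub = Subset ; _≼_ = _⊆_ ; _≼?_ = _⊆?_ ; HasRank = HasSize ; rkV = n }

fieldRing : HeytingField 0ℓ 0ℓ 0ℓ → CommutativeRing 0ℓ 0ℓ
fieldRing F =
  HeytingCommutativeRing.commutativeRing (HeytingField.heytingCommutativeRing F)

module Linear (F : HeytingField 0ℓ 0ℓ 0ℓ) (M : Module (fieldRing F) 0ℓ 0ℓ) where

  open HeytingField F using (0#) renaming (Carrier to Scalar; _≈_ to _≈F_)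
  open Module M
  open MonoidSum +ᴹ-monoid using (sum)

  record Subspace : Set where
    field
      member  : Carrierᴹ → Bool
      resp    : ∀ {v w} → v ≈ᴹ w → T (member v) → T (member w)
      0-mem   : T (member 0ᴹ)
      +-mem   : ∀ {v w} → T (member v) → T (member w) → T (member (v +ᴹ w))
      *ₗ-mem  : ∀ c {v} → T (member v) → T (member (c *ₗ v))

  open Subspace public

  _⊆_ : Rel Subspace 0ℓ
  U ⊆ W = ∀ v → T (member U v) → T (member W v)

  whole : Subspace
  whole = record
    { member = const true ; resp = λ _ _ → tt ; 0-mem = tt
    ; +-mem = λ _ _ → tt ; *ₗ-mem = λ _ _ → tt }

  combination : ∀ {r} → (Fin r → Scalar) → (Fin r → Carrierᴹ) → Carrierᴹ
  combination c b = sum (λ i → c i *ₗ b i)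

  record IsBasis (U : Subspace) {r : ℕ} (b : Fin r → Carrierᴹ) : Set where
    field
      inside      : ∀ i → T (member U (b i))
      independent : ∀ c → combination c b ≈ᴹ 0ᴹ → ∀ i → c i ≈F 0#
      spanning    : ∀ v → T (member U v) → ∃ λ c → v ≈ᴹ combination c b

  HasDim : Subspace → ℕ → Set
  HasDim U r = Σ (Fin r → Carrierᴹ) (IsBasis U)

-- A field with q elements is a field whose setoid is in bijection with
-- Fin q; q is then automatically a prime power.

module FiniteVectorSpace
  (F : HeytingField 0ℓ 0ℓ 0ℓ) (q : ℕ)
  (F↔Fin : Inverse (CommutativeRing.setoid (fieldRing F)) (setoid (Fin q)))
  (M : Module (fieldRing F) 0ℓ 0ℓ) (n : ℕ) (dimM : Linear.HasDim F M (Linear.whole F M) n)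
  where

  open Linear F M public
  open Module M
  open MonoidSum +ᴹ-monoid using (sum-cong-≋)
  open CommutativeRing (fieldRing F) using () renaming (sym to ≈F-sym; trans to ≈F-trans)
  open Inverse F↔Fin using (to; from; from-cong; strictlyInverseʳ)

  private
    b = proj₁ dimM

    vec : Fin (q ℕ.^ n) → Carrierᴹ
    vec i = combination (λ j → from (finToFun i j)) b

    vec-onto : ∀ v → ∃ λ i → v ≈ᴹ vec i
    vec-onto v =
      let (c , v≈) = IsBasis.spanning (proj₂ dimM) v tt
          i = funToFin (to ∘ c)
      in i , ≈ᴹ-trans v≈ (sum-cong-≋ λ j → *ₗ-cong
           (≈F-sym (≈F-trans (from-cong (finToFun-funToFin (to ∘ c) j))
                             (strictlyInverseʳ (c j))))
           ≈ᴹ-refl)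

  _⊆?_ : Binary.Decidable _⊆_
  U ⊆? W = map′
    (λ h v v∈U → let (i , v≈) = vec-onto v in
       resp W (≈ᴹ-sym v≈) (h i (resp U v≈ v∈U)))
    (λ h i → h (vec i))
    (all? λ i → T? (member U (vec i)) →-dec T? (member W (vec i)))

  subspaces : Geometry
  subspaces = record
    { Sub = Subspace ; _≼_ = _⊆_ ; _≼?_ = _⊆?_ ; HasRank = HasDim ; rkV = n }

data Space : Set₁ where
  finiteSet : (A : Set) (n : ℕ) → A ↔ Fin n → Space
  vectorSpace :
    (F : HeytingField 0ℓ 0ℓ 0ℓ) (q : ℕ) →
    Inverse (CommutativeRing.setoid (fieldRing F)) (setoid (Fin q)) →
    (M : Module (fieldRing F) 0ℓ 0ℓ) (n : ℕ) →
    Linear.HasDim F M (Linear.whole F M) n → Space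

geometry : Space → Geometry
geometry (finiteSet A n A↔Fin) = FiniteSet.subsets A n A↔Fin
geometry (vectorSpace F q F↔Fin M n dimM) =
  FiniteVectorSpace.subspaces F q F↔Fin M n dimM

------------------------------------------------------------------------

module Degree (G : Geometry) where

  open Geometry G public

  Layer : ℕ → Set
  Layer k = ∃ λ K → HasRank K k

  χ : ∀ {k} {P : Pred (Layer k) 0ℓ} → Decidable P → Layer k → ℝ
  χ P? K = if does (P? K) then 1ℝ else 0ℝ

  x : Sub → ∀ k → Layer k → ℝ
  x U k = χ (λ K → U ≼? proj₁ K)

  -- f ∈ V̄ᵢ⁽ᵏ⁾: f is a finite real linear combination of the x_I⁽ᵏ⁾ with
  -- rk I = i.  Such an f takes equal values on equal subspaces.
  V̄ : ℕ → ∀ k → Pred (Layer k → ℝ) 0ℓ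
  V̄ i k f = Σ (List (ℝ × Layer i)) λ cs →
    ∀ K → f K ≃ sumℝ (map (λ (c , I) → c *ℝ x (proj₁ I) k K) cs)

  IsZero : ∀ {k} → Pred (Layer k → ℝ) 0ℓ
  IsZero f = ∀ K → f K ≃ 0ℝ

  -- The relation deg f = d, where ⊥₋ stands for −∞.
  HasDegree : ∀ {k} → (Layer k → ℝ) → ℕ ₋ → Set
  HasDegree f ⊥₋ = IsZero f
  HasDegree {k} f [ t ] =
    ¬ IsZero f ×
    t ℕ.≤ k ⊓ (rkV ∸ k) ×
    V̄ t k f ×
    (∀ s → s ℕ.≤ k ⊓ (rkV ∸ k) → V̄ s k f → t ℕ.≤ s)

  SetHasDegree : ∀ {k} {P : Pred (Layer k) 0ℓ} → Decidable P → ℕ ₋ → Set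
  SetHasDegree P? = HasDegree (χ P?)

  ℱ : ∀ k → Sub → Sub → Pred (Layer k) 0ℓ
  ℱ k I J (K , _) = I ≼ K × K ≼ J

  ℱ? : ∀ k I J → Decidable (ℱ k I J)
  ℱ? k I J (K , _) = (I ≼? K) ×-dec (K ≼? J)

{-# OPTIONS --safe #-}
-- Call the elements of V (sets) or its vectors (spaces) points, and dually
-- complements of points or linear functionals copoints.  The number
-- of points in U and the number of copoints containing U depend only on
-- rk U.
--
-- Upper bound.  If J′ covers J, then summing χ{T ≤ K ≤ J′} over
-- T = U ∨ p for the points p of J′ off J (off U) gives a constant multiple
-- of χ{U ≤ K ≤ J′, K ≰ J} (of χ{U ≤ K ≤ J′}), so by induction on the corank
-- j of J the interval [U, J] has degree at most rk U + j as long as this is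
-- at most k.  For U = 0 and rk J = k these are the indicators of single
-- spaces, of degree at most n − k if n − k ≤ k, which span everything.
--
-- Lower bound.  For t = min(i + j, k, n − k) we build a rational functional
-- that vanishes on all x_S with rk S < t and takes the value 1 on ℱ(I, J).
-- Given a functional for the interval [B ∨ b, H ∧ g], replace each L by
-- L minus a multiple of the sum of all (L ∧ γ) ∨ c with b ∉ γ ≥ B,
-- c ∈ H, c ∉ g.  On x_S this acts as a multiple of x_{(S ∧ g) ∨ b}, the
-- multiple being 0 in the top rank, so one more rank is annihilated.  If
-- b ∈ I or J ≤ g, the new spaces are not in ℱ(I, J).
module Submission where

open import Defs
open import Level using (0ℓ)
open import Algebra.Apartness.Bundles using (HeytingField)
import Algebra.Apartness.Properties.HeytingCommutativeRing as HeytingProperties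
open import Algebra.Bundles using (CommutativeMonoid; CommutativeRing; Semiring)
open import Algebra.Module.Bundles using (Module)
import Algebra.Properties.CommutativeMonoid.Sum as CommutativeMonoidSum
import Algebra.Properties.CommutativeSemigroup as CommutativeSemigroupProperties
import Algebra.Properties.Group as GroupProperties
import Algebra.Properties.Ring as RingProperties
import Algebra.Properties.Semiring.Sum as SemiringSum
open import Data.Bool.Base using (Bool; true; false; if_then_else_; T; not; _∧_; _∨_)
open import Data.Bool.Properties using (T-∧; T-∨; T-irrelevant)
open import Data.Empty using (⊥-elim)
open import Data.Fin.Base using (Fin; zero; suc; combine; finToFun; funToFin)
open import Data.Fin.Permutation using (↔⇒≡)
open import Data.Fin.Properties using (any?; _≟_; +↔⊎; funToFin-finToFin; finToFun-funToFin)
import Data.Integer.Base as ℤ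
open import Data.List.Base using (List; []; _∷_; _++_; map)
open import Data.Nat.Base as ℕ using (ℕ; zero; suc; _+_; _∸_; _⊓_; _≤_; _<_; z≤n; s≤s)
import Data.Nat.Properties as ℕ
open import Data.Nat.Properties using (_<?_)
open import Data.Product.Base using (Σ; ∃; _×_; _,_; proj₁; proj₂)
open import Data.Rational.Base as ℚ using (ℚ; 0ℚ; 1ℚ; ½)
import Data.Rational.Properties as ℚ
open import Data.Rational.Solver using (module +-*-Solver)
open import Data.Sum.Base using (_⊎_; inj₁; inj₂)
open import Data.Sum.Function.Propositional using (_⊎-↔_)
open import Data.Unit.Base using (tt)
open import Function.Base using (_∘_)
open import Function.Bundles using (Inverse; Equivalence; _↔_; mk↔ₛ′)
open import Function.Properties.Inverse using (↔-sym; ↔-trans)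
open import Relation.Binary.PropositionalEquality hiding (resp; [_])
import Relation.Binary.Reasoning.Setoid as SetoidReasoning
open import Relation.Nullary.Construct.Add.Infimum using (⊥₋; [_])
open import Relation.Nullary.Decidable using
  (Dec; yes; no; does; ¬?; T?; map′; _×-dec_; _⊎-dec_; dec-true; dec-false; decidable-stable)
open import Relation.Nullary.Negation using (¬_; contradiction)

-- Counting and rational sums over finite index sets.

ℚ-semiring : Semiring _ _
ℚ-semiring = CommutativeRing.semiring ℚ.+-*-commutativeRing

open SemiringSum ℚ-semiring using (sum; sum-cong-≗; ∑-distrib-+; *-distribˡ-sum)

count : ∀ {N} → (Fin N → Bool) → ℕ
count {zero}  P = 0
count {suc N} P = (if P zero then 1 else 0) + count (P ∘ suc)

count-mono-≤ : ∀ {N} (P Q : Fin N → Bool) → (∀ i → T (P i) → T (Q i)) → count P ≤ count Q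
count-mono-≤ {zero}  P Q P⊆Q = z≤n
count-mono-≤ {suc N} P Q P⊆Q =
  ℕ.+-mono-≤ (bit (P zero) (Q zero) (P⊆Q zero)) (count-mono-≤ (P ∘ suc) (Q ∘ suc) (P⊆Q ∘ suc))
  where
  bit : ∀ b c → (T b → T c) → (if b then 1 else 0) ≤ (if c then 1 else 0)
  bit false c     h = z≤n
  bit true  true  h = ℕ.≤-refl
  bit true  false h = ⊥-elim (h _)

T-does : ∀ {P : Set} (d : Dec P) → T (does d) → P
T-does (yes p) _ = p

does-T : ∀ {P : Set} (d : Dec P) → P → T (does d)
does-T (yes _) p = _
does-T (no ¬p) p = ¬p p

ι : ℕ → ℚ
ι zero    = 0ℚ
ι (suc n) = 1ℚ ℚ.+ ι n

0<1 : 0ℚ ℚ.< 1ℚ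
0<1 = ℚ.positive⁻¹ 1ℚ

0≤ι : ∀ n → 0ℚ ℚ.≤ ι n
0≤ι zero    = ℚ.≤-refl
0≤ι (suc n) = ℚ.+-mono-≤ (ℚ.<⇒≤ 0<1) (0≤ι n)

ι-mono-< : ∀ {m n} → m < n → ι m ℚ.< ι n
ι-mono-< {zero}  {suc n} _         = ℚ.+-mono-<-≤ 0<1 (0≤ι n)
ι-mono-< {suc m} {suc n} (s≤s m<n) = ℚ.+-monoʳ-< 1ℚ (ι-mono-< m<n)

ind : ∀ {P : Set} → Dec P → ℚ
ind d = if does d then 1ℚ else 0ℚ

module _ {P : Set} where

  ind-yes : (d : Dec P) → P → ind d ≡ 1ℚ
  ind-yes d p rewrite dec-true d p = refl

  ind-no : (d : Dec P) → ¬ P → ind d ≡ 0ℚ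
  ind-no d ¬p rewrite dec-false d ¬p = refl

  ind-guard : (d : Dec P) {x y : ℚ} → (P → x ≡ y) → ind d ℚ.* x ≡ ind d ℚ.* y
  ind-guard (yes p) x≡y = cong (1ℚ ℚ.*_) (x≡y p)
  ind-guard (no _) {x} {y} _ = trans (ℚ.*-zeroˡ x) (sym (ℚ.*-zeroˡ y))

module _ {P Q : Set} where

  ind-⇔ : (d : Dec P) (e : Dec Q) → (P → Q) → (Q → P) → ind d ≡ ind e
  ind-⇔ (yes p) e f g = sym (ind-yes e (f p))
  ind-⇔ (no ¬p) e f g = sym (ind-no e (¬p ∘ g))

  ind-× : (d : Dec P) (e : Dec Q) → ind (d ×-dec e) ≡ ind d ℚ.* ind e
  ind-× (yes _) e = sym (ℚ.*-identityˡ (ind e))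
  ind-× (no _)  e = sym (ℚ.*-zeroˡ (ind e))

  ind-∖ : (d : Dec P) (e : Dec Q) → (Q → P) → ind (d ×-dec ¬? e) ≡ ind d ℚ.- ind e
  ind-∖ (yes _) (yes _) Q⊆P = refl
  ind-∖ (yes _) (no _)  Q⊆P = refl
  ind-∖ (no ¬p) (yes q) Q⊆P = contradiction (Q⊆P q) ¬p
  ind-∖ (no _)  (no _)  Q⊆P = refl

sum-ind : ∀ {N} {P : Fin N → Set} (P? : ∀ i → Dec (P i)) →
  sum (λ i → ind (P? i)) ≡ ι (count (λ i → does (P? i)))
sum-ind {zero}  P? = refl
sum-ind {suc N} P? = trans (cong (ind (P? zero) ℚ.+_) (sum-ind (P? ∘ suc))) (bit (does (P? zero)) _)
  where
  bit : ∀ b n → (if b then 1ℚ else 0ℚ) ℚ.+ ι n ≡ ι ((if b then 1 else 0) + n)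
  bit true  n = refl
  bit false n = ℚ.+-identityˡ (ι n)

sum-∖ : ∀ {N} {P Q : Fin N → Set} (P? : ∀ i → Dec (P i)) (Q? : ∀ i → Dec (Q i)) →
  (∀ i → Q i → P i) →
  sum (λ i → ind (P? i ×-dec ¬? (Q? i))) ≡ sum (λ i → ind (P? i)) ℚ.- sum (λ i → ind (Q? i))
sum-∖ P? Q? Q⊆P = begin
  D                ≡⟨ solve 2 (λ d q → d := (d :+ q) :- q) refl D SQ ⟩
  (D ℚ.+ SQ) ℚ.- SQ
    ≡⟨ cong (ℚ._- SQ) (trans (sym (∑-distrib-+ (λ i → ind (P? i ×-dec ¬? (Q? i))) (λ i → ind (Q? i))))
         (sum-cong-≗ λ i → trans (cong (ℚ._+ ind (Q? i)) (ind-∖ (P? i) (Q? i) (Q⊆P i)))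
           (solve 2 (λ p q → (p :- q) :+ q := p) refl (ind (P? i)) (ind (Q? i))))) ⟩
  SP ℚ.- SQ ∎
  where
  open ≡-Reasoning
  open +-*-Solver
  D  = sum (λ i → ind (P? i ×-dec ¬? (Q? i)))
  SP = sum (λ i → ind (P? i))
  SQ = sum (λ i → ind (Q? i))

reciprocal : ∀ {q} → 0ℚ ℚ.< q → ∃ λ r → r ℚ.* q ≡ 1ℚ
reciprocal {q} 0<q = ℚ.1/ q , ℚ.*-inverseˡ q
  where instance
    _ = ℚ.positive 0<q
    _ = ℚ.pos⇒nonZero q

-- Formal rational linear combinations; eval t f extends f linearly.
data Lin (X : Set) : Set where
  O   : Lin X
  δ   : X → Lin X
  _⊕_ : Lin X → Lin X → Lin X
  _⊙_ : ℚ → Lin X → Lin X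

module _ {X : Set} where

  eval : Lin X → (X → ℚ) → ℚ
  eval O       f = 0ℚ
  eval (δ x)   f = f x
  eval (t ⊕ u) f = eval t f ℚ.+ eval u f
  eval (a ⊙ t) f = a ℚ.* eval t f

  eval-cong : ∀ t {f g : X → ℚ} → (∀ x → f x ≡ g x) → eval t f ≡ eval t g
  eval-cong O       f≗g = refl
  eval-cong (δ x)   f≗g = f≗g x
  eval-cong (t ⊕ u) f≗g = cong₂ ℚ._+_ (eval-cong t f≗g) (eval-cong u f≗g)
  eval-cong (a ⊙ t) f≗g = cong (a ℚ.*_) (eval-cong t f≗g)

  eval-* : ∀ t a (f : X → ℚ) → eval t (λ x → a ℚ.* f x) ≡ a ℚ.* eval t f
  eval-* O       a f = sym (ℚ.*-zeroʳ a)
  eval-* (δ x)   a f = refl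
  eval-* (t ⊕ u) a f = trans (cong₂ ℚ._+_ (eval-* t a f) (eval-* u a f))
    (sym (ℚ.*-distribˡ-+ a (eval t f) (eval u f)))
  eval-* (b ⊙ t) a f = trans (cong (b ℚ.*_) (eval-* t a f))
    (solve 3 (λ a b x → b :* (a :* x) := a :* (b :* x)) refl a b (eval t f))
    where open +-*-Solver

  eval-+ : ∀ t (f g : X → ℚ) → eval t (λ x → f x ℚ.+ g x) ≡ eval t f ℚ.+ eval t g
  eval-+ O       f g = refl
  eval-+ (δ x)   f g = refl
  eval-+ (t ⊕ u) f g = trans (cong₂ ℚ._+_ (eval-+ t f g) (eval-+ u f g))
    (solve 4 (λ a b c d → (a :+ b) :+ (c :+ d) := (a :+ c) :+ (b :+ d)) refl
      (eval t f) (eval t g) (eval u f) (eval u g))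
    where open +-*-Solver
  eval-+ (b ⊙ t) f g = trans (cong (b ℚ.*_) (eval-+ t f g)) (ℚ.*-distribˡ-+ b (eval t f) (eval t g))

  ⨁ : ∀ {m} → (Fin m → Lin X) → Lin X
  ⨁ {zero}  t = O
  ⨁ {suc m} t = t zero ⊕ ⨁ (t ∘ suc)

  eval-⨁ : ∀ {m} (t : Fin m → Lin X) f → eval (⨁ t) f ≡ sum (λ i → eval (t i) f)
  eval-⨁ {zero}  t f = refl
  eval-⨁ {suc m} t f = cong (eval (t zero) f ℚ.+_) (eval-⨁ (t ∘ suc) f)

  -- The guarded term may use the proof of `P`, so a sum over all indices can contain terms that
  -- exist only under a side condition.
  when : ∀ {P : Set} → Dec P → (P → Lin X) → Lin X
  when (yes p) t = t p
  when (no _)  t = O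

  eval-when : ∀ {P : Set} (d : Dec P) (t : P → Lin X) f {a} →
    (∀ p → eval (t p) f ≡ a) → eval (when d t) f ≡ ind d ℚ.* a
  eval-when (yes p) t f {a} h = trans (h p) (sym (ℚ.*-identityˡ a))
  eval-when (no _)  t f {a} h = sym (ℚ.*-zeroˡ a)

bind : ∀ {X Y : Set} → Lin Y → (Y → Lin X) → Lin X
bind O       h = O
bind (δ y)   h = h y
bind (t ⊕ u) h = bind t h ⊕ bind u h
bind (a ⊙ t) h = a ⊙ bind t h

eval-bind : ∀ {X Y : Set} (t : Lin Y) (h : Y → Lin X) f →
  eval (bind t h) f ≡ eval t (λ y → eval (h y) f)
eval-bind O       h f = refl
eval-bind (δ y)   h f = refl
eval-bind (t ⊕ u) h f = cong₂ ℚ._+_ (eval-bind t h f) (eval-bind u h f)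
eval-bind (a ⊙ t) h f = cong (a ℚ.*_) (eval-bind t h f)

-- Geometries with points and copoints

-- A point is an element of the set, or a vector; U ▹ p is the subspace
-- generated by U and p.
record Pointed (G : Geometry) : Set₁ where
  open Geometry G public
  infix 4 _∈_ _∈?_
  infixl 6 _▹_
  field
    N       : ℕ
    _∈_     : Fin N → Sub → Set
    _∈?_    : ∀ p U → Dec (p ∈ U)
    ≼⇒⊆     : ∀ {U W p} → U ≼ W → p ∈ U → p ∈ W
    ⊆⇒≼     : ∀ {U W} → (∀ p → p ∈ U → p ∈ W) → U ≼ W
    ⊥ ⊤     : Sub
    ⊥-least : ∀ {U} → ⊥ ≼ U
    ⊤-great : ∀ {U} → U ≼ ⊤
    _▹_     : Sub → Fin N → Sub
    ∈-▹     : ∀ {U p} → p ∈ U ▹ p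
    ≼-▹     : ∀ {U p} → U ≼ U ▹ p
    ▹-least : ∀ {U p W} → U ≼ W → p ∈ W → U ▹ p ≼ W
    rk      : Sub → ℕ
    rk-⊥    : rk ⊥ ≡ 0
    rk-⊤    : rk ⊤ ≡ rkV
    rk-▹    : ∀ {U p} → ¬ p ∈ U → rk (U ▹ p) ≡ suc (rk U)
    -- The number of points in a subspace of rank `r`: this is `r` for sets and `q ^ r` for spaces,
    -- where the zero vector counts.
    κ       : ℕ → ℕ
    κ-mono  : ∀ {r s} → r < s → κ r < κ s
    size    : ∀ U → count (λ p → does (p ∈? U)) ≡ κ (rk U)

  ≼-refl : ∀ {U} → U ≼ U
  ≼-refl = ⊆⇒≼ λ _ p∈U → p∈U

  ≼-trans : ∀ {U W X} → U ≼ W → W ≼ X → U ≼ X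
  ≼-trans U≼W W≼X = ⊆⇒≼ λ _ p∈U → ≼⇒⊆ W≼X (≼⇒⊆ U≼W p∈U)

  κ-cancel : ∀ {r s} → κ r ≤ κ s → r ≤ s
  κ-cancel κr≤κs = ℕ.≮⇒≥ λ s<r → ℕ.<⇒≱ (κ-mono s<r) κr≤κs

  rk-mono : ∀ {U W} → U ≼ W → rk U ≤ rk W
  rk-mono {U} {W} U≼W = κ-cancel (subst₂ _≤_ (size U) (size W)
    (count-mono-≤ _ _ λ p → does-T (p ∈? W) ∘ ≼⇒⊆ U≼W ∘ T-does (p ∈? U)))

  outside : ∀ {U W} → ¬ U ≼ W → ∃ λ p → p ∈ U × ¬ p ∈ W
  outside {U} {W} U⋠W with any? (λ p → (p ∈? U) ×-dec ¬? (p ∈? W))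
  ... | yes found = found
  ... | no none   = contradiction
    (⊆⇒≼ λ p p∈U → decidable-stable (p ∈? W) λ p∉W → none (p , p∈U , p∉W)) U⋠W

  rk-< : ∀ {U W} → rk W < rk U → ∃ λ p → p ∈ U × ¬ p ∈ W
  rk-< W<U = outside λ U≼W → ℕ.<⇒≱ W<U (rk-mono U≼W)

  -- A point of `W` off `U` would generate together with `U` a subspace of `W` of rank `suc (rk U)`.
  ≼-rk : ∀ {U W} → U ≼ W → rk W ≤ rk U → W ≼ U
  ≼-rk {U} {W} U≼W W≤U with W ≼? U
  ... | yes W≼U = W≼U
  ... | no W⋠U  = let (p , p∈W , p∉U) = outside W⋠U in contradiction
    (ℕ.≤-trans (subst (_≤ rk W) (rk-▹ p∉U) (rk-mono (▹-least U≼W p∈W))) W≤U) (ℕ.<-irrefl refl)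

  rk-▹-≤ : ∀ U p → rk (U ▹ p) ≤ suc (rk U)
  rk-▹-≤ U p with p ∈? U
  ... | yes p∈U = ℕ.≤-trans (rk-mono (▹-least ≼-refl p∈U)) (ℕ.n≤1+n _)
  ... | no p∉U  = ℕ.≤-reflexive (rk-▹ p∉U)

  rk-≤ : ∀ U → rk U ≤ rkV
  rk-≤ U = subst (rk U ≤_) rk-⊤ (rk-mono ⊤-great)

  -- Induction from `W` down to `U`, one point at a time, with `m` bounding the number of points
  -- still to be adjoined. The base case takes two inclusions because equal subspaces need not be
  -- identical.
  module Chain (P : Sub → Set) {W : Sub}
    (base : ∀ {U} → U ≼ W → W ≼ U → P U)
    (step : ∀ {U p} → U ≼ W → p ∈ W → ¬ p ∈ U → P (U ▹ p) → P U) where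

    private
      go : ∀ m {U} → rk W ≤ rk U + m → U ≼ W → P U
      go zero    {U} W≤ U≼W = base U≼W (≼-rk U≼W (subst (rk W ≤_) (ℕ.+-identityʳ (rk U)) W≤))
      go (suc m) {U} W≤ U≼W with W ≼? U
      ... | yes W≼U = base U≼W W≼U
      ... | no W⋠U  = let (p , p∈W , p∉U) = outside W⋠U in
        step U≼W p∈W p∉U (go m
          (subst (rk W ≤_) (trans (ℕ.+-suc (rk U) m) (cong (_+ m) (sym (rk-▹ p∉U)))) W≤)
          (▹-least U≼W p∈W))

    chain : ∀ {U} → U ≼ W → P U
    chain {U} = go (rk W) (ℕ.m≤n+m (rk W) (rk U))

  -- Points of `W` are adjoined to `U` until rank `k` is reached.
  between : ∀ {k U W} → U ≼ W → rk U ≤ k → k ≤ rk W →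
    ∃ λ K → rk K ≡ k × U ≼ K × K ≼ W
  between {k} {U} {W} U≼W U≤k k≤W = Chain.chain (λ U → rk U ≤ k → ∃ λ K → rk K ≡ k × U ≼ K × K ≼ W)
    (λ U≼W W≼U U≤k → _ , ℕ.≤-antisym U≤k (ℕ.≤-trans k≤W (rk-mono W≼U)) , ≼-refl , U≼W)
    (λ {U} {p} U≼W p∈W p∉U rec U≤k → step U≼W p∉U rec (ℕ.m≤n⇒m<n∨m≡n U≤k)) U≼W U≤k
    where
    step : ∀ {U p} → U ≼ W → ¬ p ∈ U → (rk (U ▹ p) ≤ k → ∃ λ K → rk K ≡ k × U ▹ p ≼ K × K ≼ W) →
      rk U < k ⊎ rk U ≡ k → ∃ λ K → rk K ≡ k × U ≼ K × K ≼ W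
    step U≼W p∉U rec (inj₂ U≡k) = _ , U≡k , ≼-refl , U≼W
    step U≼W p∉U rec (inj₁ U<k) =
      let (K , K≡k , Up≼K , K≼W) = rec (subst (_≤ k) (sym (rk-▹ p∉U)) U<k)
      in K , K≡k , ≼-trans ≼-▹ Up≼K , K≼W

  -- The number of points that a subspace of rank `r` has off a subspace of rank `s` contained in
  -- it.
  Δ : ℕ → ℕ → ℚ
  Δ r s = ι (κ r) ℚ.- ι (κ s)

  Δ-pos : ∀ {r s} → s < r → 0ℚ ℚ.< Δ r s
  Δ-pos {r} {s} s<r = subst (ℚ._< Δ r s) (ℚ.+-inverseʳ (ι (κ s)))
    (ℚ.+-monoˡ-< (ℚ.- ι (κ s)) (ι-mono-< (κ-mono s<r)))

-- In the linear case copoints are linear functionals and hyp is the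
-- kernel; the zero functional is included, so hyp g may be ⊤.
record Copointed {G : Geometry} (X : Pointed G) : Set₁ where
  open Pointed X
  infixl 7 _∩_
  field
    hasRank     : ∀ U → HasRank U (rk U)
    rk-unique   : ∀ {U r} → HasRank U r → rk U ≡ r
    _∩_         : Sub → Sub → Sub
    ∩-≼ˡ        : ∀ {U W} → U ∩ W ≼ U
    ∩-≼ʳ        : ∀ {U W} → U ∩ W ≼ W
    ∩-greatest  : ∀ {U W X} → X ≼ U → X ≼ W → X ≼ U ∩ W
    -- The modular law `U ∩ (W ▹ p) = (U ∩ W) ▹ p` for `p ∈ U`, specialised to `U ≼ W ▹ p`.
    modular     : ∀ {U W p} → p ∈ U → U ≼ W ▹ p → U ≼ U ∩ W ▹ p
    N′          : ℕ
    hyp         : Fin N′ → Sub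
    hyp-▹       : ∀ {g p} → ¬ p ∈ hyp g → ⊤ ≼ hyp g ▹ p
    -- The copoints above `U` correspond to the points of a complement of `U` (sets) or of its
    -- annihilator (spaces), of rank `rkV ∸ rk U`.
    cosize      : ∀ U → count (λ g → does (U ≼? hyp g)) ≡ κ (rkV ∸ rk U)

-- The upper bound

module Interval {G : Geometry} {X : Pointed G} (Y : Copointed X) where

  open Pointed X
  open Copointed Y
  open Degree G using (Layer)

  point-≼ : ∀ {U p} → ⊥ ▹ p ≼ U → p ∈ U
  point-≼ p≼U = ≼⇒⊆ p≼U ∈-▹

  ∈-∩ : ∀ {U W p} → p ∈ U → p ∈ W → p ∈ U ∩ W
  ∈-∩ p∈U p∈W = point-≼ (∩-greatest (▹-least ⊥-least p∈U) (▹-least ⊥-least p∈W))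

  ∩⇒ʳ : ∀ {U W p} → p ∈ U ∩ W → p ∈ W
  ∩⇒ʳ = ≼⇒⊆ ∩-≼ʳ

  -- By the modular law `U` is generated by `U ∩ W` and `p`.
  rk-∩ : ∀ {U W p} → p ∈ U → ¬ p ∈ W → U ≼ W ▹ p → rk U ≡ suc (rk (U ∩ W))
  rk-∩ {U} {W} {p} p∈U p∉W U≼ = trans
    (ℕ.≤-antisym (rk-mono (modular p∈U U≼)) (rk-mono (▹-least ∩-≼ˡ p∈U)))
    (rk-▹ (p∉W ∘ ∩⇒ʳ))

  rk-∩-hyp : ∀ {U p g} → p ∈ U → ¬ p ∈ hyp g → rk U ≡ suc (rk (U ∩ hyp g))
  rk-∩-hyp p∈U p∉g = rk-∩ p∈U p∉g (≼-trans ⊤-great (hyp-▹ p∉g))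

  -- The intersection contains `U` and is a hyperplane of `U ▹ p`, so its rank is that of `U`.
  ∩-▹ : ∀ {U W p} → U ≼ W → ¬ p ∈ W → (U ▹ p) ∩ W ≼ U
  ∩-▹ {U} {W} {p} U≼W p∉W = ≼-rk (∩-greatest ≼-▹ U≼W) (ℕ.≤-reflexive (ℕ.suc-injective (begin
    suc (rk ((U ▹ p) ∩ W))
      ≡⟨ rk-∩ ∈-▹ p∉W (▹-least (≼-trans U≼W ≼-▹) ∈-▹) ⟨
    rk (U ▹ p)
      ≡⟨ rk-▹ (p∉W ∘ ≼⇒⊆ U≼W) ⟩
    suc (rk U) ∎)))
    where open ≡-Reasoning

  sum-points-∖ : ∀ {U W} → W ≼ U →
    sum (λ p → ind ((p ∈? U) ×-dec ¬? (p ∈? W))) ≡ Δ (rk U) (rk W)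
  sum-points-∖ {U} {W} W≼U = trans (sum-∖ (_∈? U) (_∈? W) (λ _ → ≼⇒⊆ W≼U))
    (cong₂ ℚ._-_ (trans (sum-ind (_∈? U)) (cong ι (size U))) (trans (sum-ind (_∈? W)) (cong ι (size W))))

  sum-copoints-∖ : ∀ {U W} → U ≼ W →
    sum (λ g → ind ((U ≼? hyp g) ×-dec ¬? (W ≼? hyp g))) ≡ Δ (rkV ∸ rk U) (rkV ∸ rk W)
  sum-copoints-∖ {U} {W} U≼W =
    trans (sum-∖ (λ g → U ≼? hyp g) (λ g → W ≼? hyp g) (λ _ → ≼-trans U≼W))
      (cong₂ ℚ._-_ (trans (sum-ind (λ g → U ≼? hyp g)) (cong ι (cosize U)))
                   (trans (sum-ind (λ g → W ≼? hyp g)) (cong ι (cosize W))))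

  χ[_⋯_] : Sub → Sub → Sub → ℚ
  χ[ U ⋯ W ] K = ind ((U ≼? K) ×-dec (K ≼? W))

  χ[_] : Sub → Sub → ℚ
  χ[ U ] K = ind (U ≼? K)

  module _ (k : ℕ) where

    -- The rational form of `V̄ d k`; rational coefficients are enough for the upper bound.
    Span : ℕ → (Layer k → ℚ) → Set
    Span d f = Σ (Lin (Layer d)) λ t → ∀ K → eval t (λ I → χ[ proj₁ I ] (proj₁ K)) ≡ f K

    module _ {d : ℕ} where

      span-cong : ∀ {f g} → (∀ K → f K ≡ g K) → Span d f → Span d g
      span-cong f≗g (t , t≡f) = t , λ K → trans (t≡f K) (f≗g K)

      span-* : ∀ a {f} → Span d f → Span d (λ K → a ℚ.* f K)
      span-* a (t , t≡f) = a ⊙ t , λ K → cong (a ℚ.*_) (t≡f K)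

      span-+ : ∀ {f g} → Span d f → Span d g → Span d (λ K → f K ℚ.+ g K)
      span-+ (t , t≡f) (u , u≡g) = t ⊕ u , λ K → cong₂ ℚ._+_ (t≡f K) (u≡g K)

      span-guard : ∀ {P : Set} (e : Dec P) {f} → (P → Span d f) → Span d (λ K → ind e ℚ.* f K)
      span-guard e f∈ = when e (proj₁ ∘ f∈) , λ K → eval-when e (proj₁ ∘ f∈) _ (λ p → proj₂ (f∈ p) K)

      span-sum : ∀ {m} {f : Fin m → Layer k → ℚ} → (∀ i → Span d (f i)) →
        Span d (λ K → sum (λ i → f i K))
      span-sum f∈ = ⨁ (proj₁ ∘ f∈) , λ K →
        trans (eval-⨁ (proj₁ ∘ f∈) _) (sum-cong-≗ λ i → proj₂ (f∈ i) K)

      -- Double counting: for `K` between `U` and `J`, the points `p` off `W` with `U ▹ p ≼ K` are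
      -- exactly the points of `K` off `W`.
      span-extend : ∀ {U J} W →
        (∀ p → p ∈ J → ¬ p ∈ W → Span d (χ[ U ▹ p ⋯ J ] ∘ proj₁)) →
        Span d (λ K → χ[ U ⋯ J ] (proj₁ K) ℚ.* sum (λ p → ind ((p ∈? proj₁ K) ×-dec ¬? (p ∈? W))))
      span-extend {U} {J} W U▹p∈ = span-cong
        (λ K → trans (sum-cong-≗ (pointwise (proj₁ K)))
          (sym (*-distribˡ-sum (χ[ U ⋯ J ] (proj₁ K)) (λ p → ind ((p ∈? proj₁ K) ×-dec ¬? (p ∈? W))))))
        (span-sum λ p → span-guard ((p ∈? J) ×-dec ¬? (p ∈? W)) λ (p∈J , p∉W) → U▹p∈ p p∈J p∉W)
        where
        pointwise : ∀ K p →
          ind ((p ∈? J) ×-dec ¬? (p ∈? W)) ℚ.* χ[ U ▹ p ⋯ J ] K ≡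
          χ[ U ⋯ J ] K ℚ.* ind ((p ∈? K) ×-dec ¬? (p ∈? W))
        pointwise K p = trans (sym (ind-× J∖W? Up≼K≼J?)) (trans
          (ind-⇔ (J∖W? ×-dec Up≼K≼J?) (U≼K≼J? ×-dec K∖W?)
            (λ ((_ , p∉W) , (Up≼K , K≼J)) → (≼-trans ≼-▹ Up≼K , K≼J) , (≼⇒⊆ Up≼K ∈-▹ , p∉W))
            (λ ((U≼K , K≼J) , (p∈K , p∉W)) → (≼⇒⊆ K≼J p∈K , p∉W) , (▹-least U≼K p∈K , K≼J)))
          (ind-× U≼K≼J? K∖W?))
          where
          J∖W?    = (p ∈? J) ×-dec ¬? (p ∈? W)
          K∖W?    = (p ∈? K) ×-dec ¬? (p ∈? W)
          Up≼K≼J? = (U ▹ p ≼? K) ×-dec (K ≼? J)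
          U≼K≼J?  = (U ≼? K) ×-dec (K ≼? J)

      -- Taking `W = U` in `span-extend`, every `K` in the interval is counted `Δ k (rk U)` times.
      -- This is positive and independent of `K`, so it can be divided out.
      span-average : ∀ {U J} → rk U < k →
        (∀ p → p ∈ J → ¬ p ∈ U → Span d (χ[ U ▹ p ⋯ J ] ∘ proj₁)) → Span d (χ[ U ⋯ J ] ∘ proj₁)
      span-average {U} {J} U<k U▹p∈ = span-cong scaled (span-* c (span-extend U U▹p∈))
        where
        c = proj₁ (reciprocal (Δ-pos U<k))
        c* = proj₂ (reciprocal (Δ-pos U<k))
        open ≡-Reasoning
        open +-*-Solver
        scaled : ∀ K → c ℚ.* (χ[ U ⋯ J ] (proj₁ K) ℚ.* sum (λ p → ind ((p ∈? proj₁ K) ×-dec ¬? (p ∈? U))))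
               ≡ χ[ U ⋯ J ] (proj₁ K)
        scaled (K , K:k) = begin
          c ℚ.* (x ℚ.* S)
            ≡⟨ cong (c ℚ.*_) (ind-guard U≼K≼J? λ (U≼K , _) →
                 trans (sum-points-∖ U≼K) (cong (λ s → Δ s (rk U)) (rk-unique K:k))) ⟩
          c ℚ.* (x ℚ.* Δ k (rk U))  ≡⟨ solve 3 (λ c x D → c :* (x :* D) := x :* (c :* D)) refl c x (Δ k (rk U)) ⟩
          x ℚ.* (c ℚ.* Δ k (rk U))  ≡⟨ cong (x ℚ.*_) c* ⟩
          x ℚ.* 1ℚ                  ≡⟨ ℚ.*-identityʳ x ⟩
          x ∎
          where
          U≼K≼J? = (U ≼? K) ×-dec (K ≼? J)
          x = χ[ U ⋯ J ] K
          S = sum (λ p → ind ((p ∈? K) ×-dec ¬? (p ∈? U)))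

    -- Write J ▹ p for a subspace covering J. Those K ≼ J ▹ p that are not
    -- contained in J have Δ k (k ∸ 1) points off J, the others none.
    span-cut : ∀ {d U J p} → 0 < k → ¬ p ∈ J →
      Span d (χ[ U ⋯ J ▹ p ] ∘ proj₁) →
      (∀ v → v ∈ J ▹ p → ¬ v ∈ J → Span d (χ[ U ▹ v ⋯ J ▹ p ] ∘ proj₁)) →
      Span d (χ[ U ⋯ J ] ∘ proj₁)
    span-cut {d} {U} {J} {p} 0<k p∉J χ∈ U▹v∈ = span-cong cut
      (span-+ χ∈ (span-* (ℚ.- c) (span-extend J U▹v∈)))
      where
      k-1<k = ℕ.∸-monoʳ-< {k} {1} {0} (s≤s z≤n) 0<k
      c  = proj₁ (reciprocal (Δ-pos k-1<k))
      c* = proj₂ (reciprocal (Δ-pos k-1<k))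
      -- For `K ≼ J ▹ p`, `c` times the number of points of `K` off `J` is the indicator of `K ⋠ J`;
      -- subtracting it leaves the `K` below `J`.
      cut : ∀ K → χ[ U ⋯ J ▹ p ] (proj₁ K) ℚ.+
              (ℚ.- c) ℚ.* (χ[ U ⋯ J ▹ p ] (proj₁ K) ℚ.* sum (λ v → ind ((v ∈? proj₁ K) ×-dec ¬? (v ∈? J))))
            ≡ χ[ U ⋯ J ] (proj₁ K)
      cut (K , K:k) = go ((U ≼? K) ×-dec (K ≼? J ▹ p))
        where
        S = sum (λ v → ind ((v ∈? K) ×-dec ¬? (v ∈? J)))
        S≡ : S ≡ Δ k (rk (K ∩ J))
        S≡ = trans (sum-cong-≗ λ v → ind-⇔ ((v ∈? K) ×-dec ¬? (v ∈? J)) ((v ∈? K) ×-dec ¬? (v ∈? K ∩ J))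
            (λ (v∈K , v∉J) → v∈K , v∉J ∘ ∩⇒ʳ) (λ (v∈K , v∉) → v∈K , v∉ ∘ ∈-∩ v∈K))
          (trans (sum-points-∖ ∩-≼ˡ) (cong (λ s → Δ s (rk (K ∩ J))) (rk-unique K:k)))
        value : (K≼J : Dec (K ≼ J)) → K ≼ J ▹ p → c ℚ.* S ≡ 1ℚ ℚ.- ind K≼J
        value (yes K≼J) K≼Jp = trans (cong (c ℚ.*_) (trans S≡
            (trans (cong (Δ k) (trans (ℕ.≤-antisym (rk-mono ∩-≼ˡ) (rk-mono (∩-greatest ≼-refl K≼J))) (rk-unique K:k)))
              (ℚ.+-inverseʳ (ι (κ k)))))) (ℚ.*-zeroʳ c)
        value (no K⋠J) K≼Jp = trans (cong (c ℚ.*_) (trans S≡ (cong (Δ k) K∩J:k-1))) c*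
          where
          v∈ = outside K⋠J
          v = proj₁ v∈
          v∈K = proj₁ (proj₂ v∈)
          v∉J = proj₂ (proj₂ v∈)
          -- `J ▹ v` and `J ▹ p` coincide by rank, so `K ∩ J` is a hyperplane of `K`.
          K≼Jv : K ≼ J ▹ v
          K≼Jv = ≼-trans K≼Jp (≼-rk (▹-least ≼-▹ (≼⇒⊆ K≼Jp v∈K))
            (ℕ.≤-reflexive (trans (rk-▹ p∉J) (sym (rk-▹ v∉J)))))
          K∩J:k-1 : rk (K ∩ J) ≡ k ∸ 1
          K∩J:k-1 = cong (_∸ 1) (trans (sym (rk-∩ v∈K v∉J K≼Jv)) (rk-unique K:k))
        go : (e : Dec (U ≼ K × K ≼ J ▹ p)) → ind e ℚ.+ (ℚ.- c) ℚ.* (ind e ℚ.* S) ≡ χ[ U ⋯ J ] K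
        go (no ¬UKJp) = trans (solve 2 (λ c s → con 0ℚ :+ (:- c) :* (con 0ℚ :* s) := con 0ℚ) refl c S)
          (sym (ind-no ((U ≼? K) ×-dec (K ≼? J)) λ (U≼K , K≼J) → ¬UKJp (U≼K , ≼-trans K≼J ≼-▹)))
          where open +-*-Solver
        go (yes (U≼K , K≼Jp)) = trans (solve 2 (λ c s → con 1ℚ :+ (:- c) :* (con 1ℚ :* s) := con 1ℚ :- c :* s) refl c S)
          (trans (cong (λ y → 1ℚ ℚ.- y) (value (K ≼? J) K≼Jp))
          (trans (solve 1 (λ x → con 1ℚ :- (con 1ℚ :- x) := x) refl (ind (K ≼? J)))
            (ind-⇔ (K ≼? J) ((U ≼? K) ×-dec (K ≼? J)) (U≼K ,_) proj₂)))
          where open +-*-Solver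

    -- Induction on the corank `j` of `J`. Passing to a cover of `J` lowers the corank by one and
    -- adjoining `v` raises the rank of `U` by one, so `d` stays fixed. For `j = 0` the interval is
    -- `χ[ U ]` itself.
    span-interval : ∀ j {d U J} → U ≼ J → rk J + j ≡ rkV → rk U + j ≡ d → d ≤ k →
      Span d (χ[ U ⋯ J ] ∘ proj₁)
    span-interval zero {d} {U} {J} U≼J J:n U:d d≤k =
      δ (U , subst (HasRank U) (trans (sym (ℕ.+-identityʳ _)) U:d) (hasRank U)) ,
      λ (K , _) → ind-⇔ (U ≼? K) ((U ≼? K) ×-dec (K ≼? J)) (λ U≼K → U≼K , ≼-trans ⊤-great ⊤≼J) proj₁
      where
      ⊤≼J : ⊤ ≼ J
      ⊤≼J = ≼-rk ⊤-great (ℕ.≤-reflexive (trans rk-⊤ (trans (sym J:n) (ℕ.+-identityʳ _))))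
    span-interval (suc j) {d} {U} {J} U≼J J:n U:d d≤k =
      span-cut (ℕ.<-≤-trans (s≤s z≤n) U<k) p∉J
        -- For the interval from `U` to the cover, rank plus corank is one less than `d`; averaging
        -- expresses it in degree `d`.
        (span-average U<k λ v v∈ v∉U → up v v∈ v∉U)
        (λ v v∈ v∉J → up v v∈ (v∉J ∘ ≼⇒⊆ U≼J))
      where
      U<k : rk U < k
      U<k = ℕ.<-≤-trans (ℕ.m<m+n (rk U) (s≤s z≤n)) (subst (_≤ k) (sym U:d) d≤k)
      J<n : rk J < rk ⊤
      J<n = subst (rk J <_) (trans J:n (sym rk-⊤)) (ℕ.m<m+n (rk J) (s≤s z≤n))
      p = proj₁ (rk-< J<n)
      p∉J = proj₂ (proj₂ (rk-< J<n))
      up : ∀ v → v ∈ J ▹ p → ¬ v ∈ U → Span d (χ[ U ▹ v ⋯ J ▹ p ] ∘ proj₁)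
      up v v∈ v∉U = span-interval j (▹-least (≼-trans U≼J ≼-▹) v∈)
        (trans (cong (_+ j) (rk-▹ p∉J)) (trans (sym (ℕ.+-suc (rk J) j)) J:n))
        (trans (cong (_+ j) (rk-▹ v∉U)) (trans (sym (ℕ.+-suc (rk U) j)) U:d)) d≤k

    -- On the layer of rank `k`, `χ[ U ]` with `rk U ≡ k` is the indicator of the single subspace
    -- `U`. Averaging then descends from rank `k` to any smaller rank.
    span-all : ∀ {d} → (∀ U → rk U ≡ k → Span d (χ[ U ] ∘ proj₁)) →
      ∀ m {U J} → U ≼ J → rk U + m ≡ k → Span d (χ[ U ⋯ J ] ∘ proj₁)
    span-all δ∈ zero {U} {J} U≼J U:k = span-cong
      (λ (K , K:k) → ind-⇔ (U ≼? K) ((U ≼? K) ×-dec (K ≼? J))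
        (λ U≼K → U≼K , ≼-trans (≼-rk U≼K (ℕ.≤-reflexive (trans (rk-unique K:k) (sym rkU)))) U≼J) proj₁)
      (δ∈ U rkU)
      where
      rkU : rk U ≡ k
      rkU = trans (sym (ℕ.+-identityʳ _)) U:k
    span-all δ∈ (suc m) {U} U≼J U:k = span-average
      (subst (rk U <_) U:k (ℕ.m<m+n (rk U) (s≤s z≤n)))
      λ p p∈J p∉U → span-all δ∈ m (▹-least U≼J p∈J)
        (trans (cong (_+ m) (rk-▹ p∉U)) (trans (sym (ℕ.+-suc (rk U) m)) U:k))

    -- Once `rk U + j` reaches `k ⊓ (rkV ∸ k)`, the indicators of single subspaces are available in
    -- that degree, and with them every interval.
    span-interval-⊓ : ∀ {U J j} → U ≼ J → rk U ≤ k → k ≤ rkV → rk J + j ≡ rkV →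
      Span ((rk U + j) ⊓ k ⊓ (rkV ∸ k)) (χ[ U ⋯ J ] ∘ proj₁)
    span-interval-⊓ {U} {J} {j} U≼J U≤k k≤n J:n with ℕ.≤-total (rk U + j) (k ⊓ (rkV ∸ k))
    ... | inj₁ ≤m = subst (λ d → Span d (χ[ U ⋯ J ] ∘ proj₁))
      (sym (trans (ℕ.⊓-assoc (rk U + j) k (rkV ∸ k)) (ℕ.m≤n⇒m⊓n≡m ≤m)))
      (span-interval j U≼J J:n refl (ℕ.≤-trans ≤m (ℕ.m⊓n≤m k (rkV ∸ k))))
    ... | inj₂ m≤ = subst (λ d → Span d (χ[ U ⋯ J ] ∘ proj₁))
      (sym (trans (ℕ.⊓-assoc (rk U + j) k (rkV ∸ k)) (ℕ.m≥n⇒m⊓n≡n m≤)))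
      (span-all deltas (k ∸ rk U) U≼J (ℕ.m+[n∸m]≡n U≤k))
      where
      deltas : ∀ W → rk W ≡ k → Span (k ⊓ (rkV ∸ k)) (χ[ W ] ∘ proj₁)
      deltas W W:k with ℕ.≤-total k (rkV ∸ k)
      ... | inj₁ k≤ = subst (λ d → Span d (χ[ W ] ∘ proj₁)) (sym (ℕ.m≤n⇒m⊓n≡m k≤))
        (δ (W , subst (HasRank W) W:k (hasRank W)) , λ _ → refl)
      -- The indicator of `W` is also the interval from `⊥` to `W`, whose top has corank `rkV ∸ k`.
      ... | inj₂ ≤k = subst (λ d → Span d (χ[ W ] ∘ proj₁)) (sym (ℕ.m≥n⇒m⊓n≡n ≤k)) (span-cong
        (λ (K , K:k) → ind-⇔ ((⊥ ≼? K) ×-dec (K ≼? W)) (W ≼? K)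
          (λ (_ , K≼W) → ≼-rk K≼W (ℕ.≤-reflexive (trans W:k (sym (rk-unique K:k)))))
          (λ W≼K → ⊥-least , ≼-rk W≼K (ℕ.≤-reflexive (trans (rk-unique K:k) (sym W:k)))))
        (span-interval (rkV ∸ k) ⊥-least (trans (cong (_+ (rkV ∸ k)) W:k) (ℕ.m+[n∸m]≡n k≤n))
          (cong (_+ (rkV ∸ k)) rk-⊥) ≤k))

-- The lower bound

module LowerBound {G : Geometry} {X : Pointed G} (Y : Copointed X) (k : ℕ) where

  open Pointed X
  open Copointed Y
  open Interval Y

  -- The lower bound is a recursion on intervals that shrink from both ends; its functionals are
  -- elements of `Lin (Block B H)`.
  Block : Sub → Sub → Set
  Block B H = ∃ λ K → rk K ≡ k × B ≼ K × K ≼ H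

  -- Subtracting from L a multiple of the sum of all M ▹ c, where M is a
  -- hyperplane of L with b ∉ M and c lies outside hyp g, lowers degrees by one.
  module Step
    {B H : Sub} {b : Fin N} {g : Fin N′} {t : ℕ}
    (B≼H : B ≼ H) (B≼g : B ≼ hyp g) (b∈H : b ∈ H) (b∈g : b ∈ hyp g) (b∉B : ¬ b ∈ B)
    (H⋠g : ¬ H ≼ hyp g) (B+t<n : rk B + t < rkV)
    where

    private
      n = rkV
      H′ = H ∩ hyp g
      B′ = B ▹ b

    Copoint? : ∀ γ → Dec (B ≼ hyp γ × ¬ b ∈ hyp γ)
    Copoint? γ = (B ≼? hyp γ) ×-dec ¬? (b ∈? hyp γ)

    Point? : ∀ c → Dec (c ∈ H × ¬ c ∈ hyp g)
    Point? c = (c ∈? H) ×-dec ¬? (c ∈? hyp g)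

    module _ {L : Sub} (L:k : rk L ≡ k) (B′≼L : B′ ≼ L) (L≼H′ : L ≼ H′)
      {γ : Fin N′} (B≼γ : B ≼ hyp γ) (b∉γ : ¬ b ∈ hyp γ) where

      M : Sub
      M = L ∩ hyp γ

      M:k : k ≡ suc (rk M)
      M:k = trans (sym L:k) (rk-∩-hyp (≼⇒⊆ B′≼L ∈-▹) b∉γ)

      M≼g : M ≼ hyp g
      M≼g = ≼-trans ∩-≼ˡ (≼-trans L≼H′ ∩-≼ʳ)

      M≼H : M ≼ H
      M≼H = ≼-trans ∩-≼ˡ (≼-trans L≼H′ ∩-≼ˡ)

      M▹:k : ∀ {c} → ¬ c ∈ hyp g → rk (M ▹ c) ≡ k
      M▹:k c∉g = trans (rk-▹ (c∉g ∘ ≼⇒⊆ M≼g)) (sym M:k)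

      M▹∩g : ∀ {c} → ¬ c ∈ hyp g → (M ▹ c) ∩ hyp g ≼ M
      M▹∩g = ∩-▹ M≼g

      extended : ∀ {c} → c ∈ H → ¬ c ∈ hyp g → Block B H
      extended {c} c∈H c∉g = M ▹ c , M▹:k c∉g ,
        ≼-trans (∩-greatest (≼-trans ≼-▹ B′≼L) B≼γ) ≼-▹ , ▹-least M≼H c∈H

      -- Inside `hyp g`, where `b` lies, `M ▹ c` reduces to `M`, and `M` is contained in `hyp γ`,
      -- which misses `b`.
      b∉extended : ∀ {c} → ¬ c ∈ hyp g → ¬ b ∈ M ▹ c
      b∉extended c∉g b∈ = b∉γ (∩⇒ʳ (≼⇒⊆ (M▹∩g c∉g) (∈-∩ b∈ b∈g)))

      exchange : ∀ {c d} → ¬ c ∈ hyp g → ¬ d ∈ hyp g → d ∈ M ▹ c → c ∈ M ▹ d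
      exchange c∉g d∉g d∈ = ≼⇒⊆ (≼-rk (▹-least ≼-▹ d∈)
        (ℕ.≤-reflexive (trans (M▹:k c∉g) (sym (M▹:k d∉g))))) ∈-▹

      extensions : Sub → ℚ
      extensions S = sum (λ c → ind (Point? c) ℚ.* χ[ S ] (M ▹ c))

      -- Since `(M ▹ c) ∩ hyp g` is `M`, the condition `S ≼ M ▹ c` means `S ≼ M` for every
      -- admissible `c`, and the sum just counts the points of `H` off `hyp g`.
      extensions-inside : ∀ {S} → S ≼ hyp g → extensions S ≡ χ[ S ] M ℚ.* Δ (rk H) (rk H′)
      extensions-inside {S} S≼g = begin
        extensions S
          ≡⟨ sum-cong-≗ (λ c → trans (ind-guard (Point? c) λ (_ , c∉g) →
               ind-⇔ (S ≼? M ▹ c) (S ≼? M)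
                 (λ S≼ → ≼-trans (∩-greatest S≼ S≼g) (M▹∩g c∉g)) (λ S≼M → ≼-trans S≼M ≼-▹))
               (ℚ.*-comm (ind (Point? c)) (χ[ S ] M))) ⟩
        sum (λ c → χ[ S ] M ℚ.* ind (Point? c))
          ≡⟨ *-distribˡ-sum (χ[ S ] M) (ind ∘ Point?) ⟨
        χ[ S ] M ℚ.* sum (ind ∘ Point?)
          ≡⟨ cong (χ[ S ] M ℚ.*_) (trans
               (sum-cong-≗ λ c → ind-⇔ (Point? c) ((c ∈? H) ×-dec ¬? (c ∈? H′))
                 (λ (c∈H , c∉g) → c∈H , c∉g ∘ ∩⇒ʳ) (λ (c∈H , c∉) → c∈H , c∉ ∘ ∈-∩ c∈H))
               (sum-points-∖ ∩-≼ˡ)) ⟩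
        χ[ S ] M ℚ.* Δ (rk H) (rk H′) ∎
        where open ≡-Reasoning

      -- Here `S` is generated by `S ∩ hyp g` and `d`, so `S ≼ M ▹ c` means `S ∩ hyp g ≼ M` and
      -- `d ∈ M ▹ c`. By exchange the latter means `c ∈ M ▹ d`, so the admissible `c` are the points
      -- of `M ▹ d` off `M`.
      extensions-across : ∀ {S d} → S ≼ H → d ∈ S → ¬ d ∈ hyp g →
        extensions S ≡ χ[ S ∩ hyp g ] M ℚ.* Δ k (k ∸ 1)
      extensions-across {S} {d} S≼H d∈S d∉g = begin
        extensions S
          ≡⟨ sum-cong-≗ (λ c → trans (sym (ind-× (Point? c) (S ≼? M ▹ c))) (trans
               (ind-⇔ (Point? c ×-dec (S ≼? M ▹ c)) ((S₀ ≼? M) ×-dec New? c) to from)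
               (ind-× (S₀ ≼? M) (New? c)))) ⟩
        sum (λ c → χ[ S₀ ] M ℚ.* ind (New? c))
          ≡⟨ *-distribˡ-sum (χ[ S₀ ] M) (ind ∘ New?) ⟨
        χ[ S₀ ] M ℚ.* sum (ind ∘ New?)
          ≡⟨ cong (χ[ S₀ ] M ℚ.*_) (trans
               (sum-cong-≗ λ c → ind-⇔ (New? c) ((c ∈? M ▹ d) ×-dec ¬? (c ∈? M))
                 (λ (c∈ , c∉g) → c∈ , c∉g ∘ ≼⇒⊆ M≼g)
                 (λ (c∈ , c∉M) → c∈ , λ c∈g → c∉M (≼⇒⊆ (M▹∩g d∉g) (∈-∩ c∈ c∈g))))
               (trans (sum-points-∖ ≼-▹) (cong₂ Δ (M▹:k d∉g) (cong (_∸ 1) (sym M:k))))) ⟩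
        χ[ S₀ ] M ℚ.* Δ k (k ∸ 1) ∎
        where
        open ≡-Reasoning
        S₀ = S ∩ hyp g
        New? : ∀ c → Dec (c ∈ M ▹ d × ¬ c ∈ hyp g)
        New? c = (c ∈? M ▹ d) ×-dec ¬? (c ∈? hyp g)
        to : ∀ {c} → (c ∈ H × ¬ c ∈ hyp g) × S ≼ M ▹ c → S₀ ≼ M × (c ∈ M ▹ d × ¬ c ∈ hyp g)
        to ((c∈H , c∉g) , S≼) =
          ≼-trans (∩-greatest (≼-trans ∩-≼ˡ S≼) ∩-≼ʳ) (M▹∩g c∉g) ,
          exchange c∉g d∉g (≼⇒⊆ S≼ d∈S) , c∉g
        from : ∀ {c} → S₀ ≼ M × (c ∈ M ▹ d × ¬ c ∈ hyp g) → (c ∈ H × ¬ c ∈ hyp g) × S ≼ M ▹ c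
        from (S₀≼M , c∈ , c∉g) =
          (≼⇒⊆ (▹-least M≼H (≼⇒⊆ S≼H d∈S)) c∈ , c∉g) ,
          ≼-trans (modular d∈S (≼-trans ⊤-great (hyp-▹ d∉g)))
            (▹-least (≼-trans S₀≼M ≼-▹) (exchange d∉g c∉g c∈))

    swaps : Block B′ H′ → Lin (Block B H)
    swaps (L , L:k , B′≼L , L≼H′) =
      ⨁ λ γ → when (Copoint? γ) λ (B≼γ , b∉γ) →
      ⨁ λ c → when (Point? c) λ (c∈H , c∉g) →
      δ (extended L:k B′≼L L≼H′ B≼γ b∉γ c∈H c∉g)

    -- The number of copoints above `S` that miss `b`.
    E : Sub → ℚ
    E S = Δ (n ∸ rk S) (n ∸ rk (S ▹ b))

    -- The two cases of S relative to hyp g differ only in S₀ and C.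
    eval-swaps : ∀ (L : Block B′ H′) {S S₀ C} → B ≼ S₀ →
      (∀ {γ} (B≼γ : B ≼ hyp γ) (b∉γ : ¬ b ∈ hyp γ) →
        let (_ , L:k , B′≼L , L≼H′) = L in
        extensions L:k B′≼L L≼H′ B≼γ b∉γ S ≡ χ[ S₀ ] (proj₁ L ∩ hyp γ) ℚ.* C) →
      eval (swaps L) (χ[ S ] ∘ proj₁) ≡ χ[ S₀ ▹ b ] (proj₁ L) ℚ.* (C ℚ.* E S₀)
    eval-swaps (L , L:k , B′≼L , L≼H′) {S} {S₀} {C} B≼S₀ ext≡ = begin
      eval (swaps (L , L:k , B′≼L , L≼H′)) f
        ≡⟨ eval-⨁ (λ γ → when (Copoint? γ) (inner γ)) f ⟩
      sum (λ γ → eval (when (Copoint? γ) (inner γ)) f)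
        ≡⟨ sum-cong-≗ (λ γ → eval-when (Copoint? γ) (inner γ) f (inner≡ γ)) ⟩
      sum (λ γ → ind (Copoint? γ) ℚ.* (χ[ S₀ ] (L ∩ hyp γ) ℚ.* C))
        ≡⟨ sum-cong-≗ regroup ⟩
      sum (λ γ → (χ[ S₀ ▹ b ] L ℚ.* C) ℚ.* ind (Between? γ))
        ≡⟨ *-distribˡ-sum (χ[ S₀ ▹ b ] L ℚ.* C) (ind ∘ Between?) ⟨
      (χ[ S₀ ▹ b ] L ℚ.* C) ℚ.* sum (ind ∘ Between?)
        ≡⟨ cong ((χ[ S₀ ▹ b ] L ℚ.* C) ℚ.*_) (sum-copoints-∖ ≼-▹) ⟩
      (χ[ S₀ ▹ b ] L ℚ.* C) ℚ.* E S₀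
        ≡⟨ ℚ.*-assoc (χ[ S₀ ▹ b ] L) C (E S₀) ⟩
      χ[ S₀ ▹ b ] L ℚ.* (C ℚ.* E S₀) ∎
      where
      open ≡-Reasoning
      f : Block B H → ℚ
      f = χ[ S ] ∘ proj₁
      point : ∀ γ → B ≼ hyp γ × ¬ b ∈ hyp γ → ∀ c → c ∈ H × ¬ c ∈ hyp g → Lin (Block B H)
      point γ (B≼γ , b∉γ) c (c∈H , c∉g) = δ (extended L:k B′≼L L≼H′ B≼γ b∉γ c∈H c∉g)
      inner : ∀ γ → B ≼ hyp γ × ¬ b ∈ hyp γ → Lin (Block B H)
      inner γ γ∈ = ⨁ λ c → when (Point? c) (point γ γ∈ c)
      inner≡ : ∀ γ γ∈ → eval (inner γ γ∈) f ≡ χ[ S₀ ] (L ∩ hyp γ) ℚ.* C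
      inner≡ γ γ∈@(B≼γ , b∉γ) = trans (eval-⨁ (λ c → when (Point? c) (point γ γ∈ c)) f)
        (trans (sum-cong-≗ λ c → eval-when (Point? c) (point γ γ∈ c) f λ _ → refl) (ext≡ B≼γ b∉γ))
      Between? : ∀ γ → Dec (S₀ ≼ hyp γ × ¬ S₀ ▹ b ≼ hyp γ)
      Between? γ = (S₀ ≼? hyp γ) ×-dec ¬? (S₀ ▹ b ≼? hyp γ)
      -- Because `b ∈ L` and `B ≼ S₀`, the condition `S₀ ▹ b ≼ L` separates from those on `γ`, and
      -- the remaining sum counts the copoints above `S₀` that miss `b`.
      regroup : ∀ γ → ind (Copoint? γ) ℚ.* (χ[ S₀ ] (L ∩ hyp γ) ℚ.* C) ≡
        (χ[ S₀ ▹ b ] L ℚ.* C) ℚ.* ind (Between? γ)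
      regroup γ = begin
        ind (Copoint? γ) ℚ.* (χ[ S₀ ] (L ∩ hyp γ) ℚ.* C)
          ≡⟨ ℚ.*-assoc (ind (Copoint? γ)) (χ[ S₀ ] (L ∩ hyp γ)) C ⟨
        ind (Copoint? γ) ℚ.* χ[ S₀ ] (L ∩ hyp γ) ℚ.* C
          ≡⟨ cong (ℚ._* C) (trans (sym (ind-× (Copoint? γ) (S₀ ≼? L ∩ hyp γ))) (trans
               (ind-⇔ (Copoint? γ ×-dec (S₀ ≼? L ∩ hyp γ)) ((S₀ ▹ b ≼? L) ×-dec Between? γ)
                 (λ ((_ , b∉γ) , S₀≼) →
                   ▹-least (≼-trans S₀≼ ∩-≼ˡ) (≼⇒⊆ B′≼L ∈-▹) ,
                   ≼-trans S₀≼ ∩-≼ʳ , λ S₀b≼γ → b∉γ (≼⇒⊆ S₀b≼γ ∈-▹))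
                 (λ (S₀b≼L , S₀≼γ , S₀b⋠γ) →
                   (≼-trans B≼S₀ S₀≼γ , λ b∈γ → S₀b⋠γ (▹-least S₀≼γ b∈γ)) ,
                   ∩-greatest (≼-trans ≼-▹ S₀b≼L) S₀≼γ))
               (ind-× (S₀ ▹ b ≼? L) (Between? γ)))) ⟩
        χ[ S₀ ▹ b ] L ℚ.* ind (Between? γ) ℚ.* C
          ≡⟨ solve 3 (λ x y c → x :* y :* c := x :* c :* y) refl (χ[ S₀ ▹ b ] L) (ind (Between? γ)) C ⟩
        χ[ S₀ ▹ b ] L ℚ.* C ℚ.* ind (Between? γ) ∎
        where open +-*-Solver

    private
      -- The scalar by which `swaps` acts on `χ[ S ]` when `S ≼ hyp g` has the top rank `rk B + t`
      -- and misses `b`; its reciprocal `ν` makes the two parts of `derive` cancel there.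
      weight : ℚ
      weight = Δ (rk H) (rk H′) ℚ.* Δ (n ∸ (rk B + t)) (n ∸ suc (rk B + t))

      h∈ = outside H⋠g

      weight-pos : 0ℚ ℚ.< weight
      weight-pos = ℚ.positive⁻¹ weight
        where instance
          _ = ℚ.positive (Δ-pos {rk H} {rk H′} (subst (rk H′ <_) (sym (rk-∩-hyp (proj₁ (proj₂ h∈)) (proj₂ (proj₂ h∈)))) ℕ.≤-refl))
          _ = ℚ.positive (Δ-pos {n ∸ (rk B + t)} {n ∸ suc (rk B + t)} (ℕ.∸-monoʳ-< ℕ.≤-refl B+t<n))
          _ = ℚ.pos*pos⇒pos (Δ (rk H) (rk H′)) (Δ (n ∸ (rk B + t)) (n ∸ suc (rk B + t)))

      ν  = proj₁ (reciprocal weight-pos)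
      ν* = proj₂ (reciprocal weight-pos)

    derive : Block B′ H′ → Lin (Block B H)
    derive L = δ (proj₁ L , proj₁ (proj₂ L) , ≼-trans ≼-▹ (proj₁ (proj₂ (proj₂ L))) , ≼-trans (proj₂ (proj₂ (proj₂ L))) ∩-≼ˡ)
      ⊕ ((ℚ.- ν) ⊙ swaps L)

    -- Every swapped space misses `b` and contains a point off `hyp g`, so `f` vanishes on all of
    -- them and only the term `L` remains.
    eval-derive : ∀ {f : Sub → ℚ} → (∀ K → B ≼ K → K ≼ H → ¬ b ∈ K → ¬ K ≼ hyp g → f K ≡ 0ℚ) →
      ∀ L → eval (derive L) (f ∘ proj₁) ≡ f (proj₁ L)
    eval-derive {f} f≡0 L = trans (cong (λ s → f (proj₁ L) ℚ.+ (ℚ.- ν) ℚ.* s) swaps≡0)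
      (solve 2 (λ x ν → x :+ (:- ν) :* con 0ℚ := x) refl (f (proj₁ L)) ν)
      where
      open +-*-Solver
      zeros : ∀ {m} {P : Fin m → Set} (P? : ∀ i → Dec (P i)) (t : ∀ i → P i → Lin (Block B H)) →
        (∀ i p → eval (t i p) (f ∘ proj₁) ≡ 0ℚ) → eval (⨁ λ i → when (P? i) (t i)) (f ∘ proj₁) ≡ 0ℚ
      zeros {zero}  P? t t≡0 = refl
      zeros {suc m} P? t t≡0 = cong₂ ℚ._+_
        (trans (eval-when (P? zero) (t zero) _ (t≡0 zero)) (ℚ.*-zeroʳ (ind (P? zero))))
        (zeros (P? ∘ suc) (t ∘ suc) (t≡0 ∘ suc))
      swaps≡0 : eval (swaps L) (f ∘ proj₁) ≡ 0ℚ
      swaps≡0 = let (_ , L:k , B′≼L , L≼H′) = L in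
        zeros Copoint? _ λ γ (B≼γ , b∉γ) → zeros Point? _ λ c (c∈H , c∉g) →
          let (_ , _ , B≼K , K≼H) = extended L:k B′≼L L≼H′ B≼γ b∉γ c∈H c∉g in
          f≡0 _ B≼K K≼H (b∉extended L:k B′≼L L≼H′ B≼γ b∉γ c∉g) (λ K≼g → c∉g (≼⇒⊆ K≼g ∈-▹))

    -- `derive` turns `χ[ S ]` into a multiple of `χ[ S₀ ▹ b ]`, with `S₀` equal to `S` or to
    -- `S ∩ hyp g`. Either the rank of `S₀ ▹ b` is small enough for `φ` to annihilate it, or the
    -- multiple is zero by the choice of `ν`.
    lift : (φ : Lin (Block B′ H′)) →
      (∀ S → B′ ≼ S → S ≼ H′ → rk S < rk B′ + t → eval φ (χ[ S ] ∘ proj₁) ≡ 0ℚ) →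
      ∀ S → B ≼ S → S ≼ H → rk S < rk B + suc t → eval (bind φ derive) (χ[ S ] ∘ proj₁) ≡ 0ℚ
    lift φ φ≡0 S B≼S S≼H S< = trans (eval-bind φ derive _) (go (S ≼? hyp g))
      where
      S≤ : rk S ≤ rk B + t
      S≤ = ℕ.s≤s⁻¹ (subst (rk S <_) (ℕ.+-suc (rk B) t) S<)
      B′: : rk B′ + t ≡ suc (rk B + t)
      B′: = cong (_+ t) (rk-▹ b∉B)

      by-scaling : ∀ a S₀ → (∀ L → eval (derive L) (χ[ S ] ∘ proj₁) ≡ a ℚ.* χ[ S₀ ▹ b ] (proj₁ L)) →
        a ≡ 0ℚ ⊎ (B ≼ S₀ × S₀ ≼ H × S₀ ≼ hyp g × rk (S₀ ▹ b) ≤ rk B + t) →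
        eval φ (λ L → eval (derive L) (χ[ S ] ∘ proj₁)) ≡ 0ℚ
      by-scaling a S₀ D≡ cases = trans (eval-cong φ D≡) (trans (eval-* φ a _) (zero-product cases))
        where
        zero-product : a ≡ 0ℚ ⊎ (B ≼ S₀ × S₀ ≼ H × S₀ ≼ hyp g × rk (S₀ ▹ b) ≤ rk B + t) →
          a ℚ.* eval φ (χ[ S₀ ▹ b ] ∘ proj₁) ≡ 0ℚ
        zero-product (inj₁ refl) = ℚ.*-zeroˡ (eval φ (χ[ S₀ ▹ b ] ∘ proj₁))
        zero-product (inj₂ (B≼S₀ , S₀≼H , S₀≼g , S₀≤)) = trans
          (cong (a ℚ.*_) (φ≡0 (S₀ ▹ b) (▹-least (≼-trans B≼S₀ ≼-▹) ∈-▹)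
            (▹-least (∩-greatest S₀≼H S₀≼g) (∈-∩ b∈H b∈g)) (subst (rk (S₀ ▹ b) <_) (sym B′:) (s≤s S₀≤))))
          (ℚ.*-zeroʳ a)

      open +-*-Solver
      b∈L : (L : Block B′ H′) → b ∈ proj₁ L
      b∈L (_ , _ , B′≼L , _) = ≼⇒⊆ B′≼L ∈-▹

      go : Dec (S ≼ hyp g) → eval φ (λ L → eval (derive L) (χ[ S ] ∘ proj₁)) ≡ 0ℚ
      go (yes S≼g) = by-scaling (1ℚ ℚ.- ν ℚ.* (Δ (rk H) (rk H′) ℚ.* E S)) S
        (λ L → let (_ , L:k , B′≼L , L≼H′) = L in trans
          (cong₂ (λ x s → x ℚ.+ (ℚ.- ν) ℚ.* s)
            (ind-⇔ (S ≼? proj₁ L) (S ▹ b ≼? proj₁ L) (λ S≼L → ▹-least S≼L (b∈L L)) (≼-trans ≼-▹))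
            (eval-swaps L {C = Δ (rk H) (rk H′)} B≼S λ B≼γ b∉γ → extensions-inside L:k B′≼L L≼H′ B≼γ b∉γ S≼g))
          (solve 3 (λ x ν e → x :+ (:- ν) :* (x :* e) := (con 1ℚ :- ν :* e) :* x) refl
            (χ[ S ▹ b ] (proj₁ L)) ν (Δ (rk H) (rk H′) ℚ.* E S)))
        (top (ℕ.≤-<-connex (rk (S ▹ b)) (rk B + t)))
        where
        top : rk (S ▹ b) ≤ rk B + t ⊎ rk B + t < rk (S ▹ b) →
          1ℚ ℚ.- ν ℚ.* (Δ (rk H) (rk H′) ℚ.* E S) ≡ 0ℚ ⊎ _
        top (inj₁ ≤t) = inj₂ (B≼S , S≼H , S≼g , ≤t)
        -- The bounds force `rk S ≡ rk B + t` and `rk (S ▹ b)` one larger, so the factor is exactly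
        -- `weight` and the scalar is `1 - 1`.
        top (inj₂ t<) = inj₁ (trans
          (cong (λ w → 1ℚ ℚ.- ν ℚ.* (Δ (rk H) (rk H′) ℚ.* w))
            (cong₂ (λ r s → Δ (n ∸ r) (n ∸ s)) S: Sb:))
          (trans (cong (λ w → 1ℚ ℚ.- w) ν*) (ℚ.+-inverseʳ 1ℚ)))
          where
          Sb: : rk (S ▹ b) ≡ suc (rk B + t)
          Sb: = ℕ.≤-antisym (ℕ.≤-trans (rk-▹-≤ S b) (s≤s S≤)) t<
          S: : rk S ≡ rk B + t
          S: = ℕ.≤-antisym S≤ (ℕ.s≤s⁻¹ (subst (_≤ suc (rk S)) Sb: (rk-▹-≤ S b)))
      go (no S⋠g) = by-scaling (ℚ.- (ν ℚ.* (Δ k (k ∸ 1) ℚ.* E S₀))) S₀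
        (λ L → let (_ , L:k , B′≼L , L≼H′) = L in trans
          (cong₂ (λ x s → x ℚ.+ (ℚ.- ν) ℚ.* s)
            (ind-no (S ≼? proj₁ L) λ S≼L → S⋠g (≼-trans S≼L (≼-trans L≼H′ ∩-≼ʳ)))
            (eval-swaps L {C = Δ k (k ∸ 1)} B≼S₀ λ B≼γ b∉γ → extensions-across L:k B′≼L L≼H′ B≼γ b∉γ S≼H d∈S d∉g))
          (solve 3 (λ x ν e → con 0ℚ :+ (:- ν) :* (x :* e) := (:- (ν :* e)) :* x) refl
            (χ[ S₀ ▹ b ] (proj₁ L)) ν (Δ k (k ∸ 1) ℚ.* E S₀)))
        -- Cutting by `hyp g` loses one rank and adjoining `b` regains at most one.
        (inj₂ (B≼S₀ , ≼-trans ∩-≼ˡ S≼H , ∩-≼ʳ , ℕ.≤-trans (rk-▹-≤ S₀ b)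
          (subst (_≤ rk B + t) (rk-∩-hyp d∈S d∉g) S≤)))
        where
        S₀ = S ∩ hyp g
        d∈S = proj₁ (proj₂ (outside S⋠g))
        d∉g = proj₂ (proj₂ (outside S⋠g))
        B≼S₀ : B ≼ S₀
        B≼S₀ = ∩-greatest B≼S B≼g

  -- A certificate that, among the rank-`k` subspaces between `B` and `H`, the interval from `I` to
  -- `J` has degree at least `t`, ranks being measured from `B`.
  Annihilator : ℕ → (B I J H : Sub) → Set
  Annihilator t B I J H = Σ (Lin (Block B H)) λ φ →
    (∀ S → B ≼ S → S ≼ H → rk S < rk B + t → eval φ (χ[ S ] ∘ proj₁) ≡ 0ℚ) ×
    eval φ (χ[ I ⋯ J ] ∘ proj₁) ≡ 1ℚ

  -- The primed interval has to agree with the original one only on the smaller block. Either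
  -- alternative, `b ∈ I` or `J ≼ hyp g`, keeps the swapped spaces out of the interval, so the value
  -- 1 survives.
  annihilator-step : ∀ {t B I J H I′ J′ b g} → B ≼ I → I ≼ J → J ≼ H → rk B + suc t ≤ k → k ≤ rkV →
    b ∈ J → b ∈ hyp g → ¬ b ∈ B → I ≼ hyp g → ¬ H ≼ hyp g →
    b ∈ I ⊎ J ≼ hyp g →
    (∀ {L} → B ▹ b ≼ L → L ≼ H ∩ hyp g → (I ≼ L × L ≼ J → I′ ≼ L × L ≼ J′) × (I′ ≼ L × L ≼ J′ → I ≼ L × L ≼ J)) →
    Annihilator t (B ▹ b) I′ J′ (H ∩ hyp g) → Annihilator (suc t) B I J H
  annihilator-step {t} {B} {I} {J} {H} {I′} {J′} {b} {g} B≼I I≼J J≼H B+t<k k≤n b∈J b∈g b∉B I≼g H⋠g only I′J′⇔ (φ , φ≡0 , φ≡1) =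
    bind φ derive , lift φ φ≡0 , (begin
      eval (bind φ derive) (χ[ I ⋯ J ] ∘ proj₁)
        ≡⟨ eval-bind φ derive _ ⟩
      eval φ (λ L → eval (derive L) (χ[ I ⋯ J ] ∘ proj₁))
        ≡⟨ eval-cong φ (λ L@(K , _ , B′≼K , K≼H′) → trans
             (eval-derive {χ[ I ⋯ J ]} (λ K _ _ b∉K K⋠g → ind-no ((I ≼? K) ×-dec (K ≼? J)) (excluded only b∉K K⋠g)) L)
             (ind-⇔ ((I ≼? K) ×-dec (K ≼? J)) ((I′ ≼? K) ×-dec (K ≼? J′))
               (proj₁ (I′J′⇔ B′≼K K≼H′)) (proj₂ (I′J′⇔ B′≼K K≼H′)))) ⟩
      eval φ (χ[ I′ ⋯ J′ ] ∘ proj₁)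
        ≡⟨ φ≡1 ⟩
      1ℚ ∎)
    where
    open ≡-Reasoning
    open Step {B} {H} {b} {g} {t} (≼-trans B≼I (≼-trans I≼J J≼H)) (≼-trans B≼I I≼g)
      (≼⇒⊆ J≼H b∈J) b∈g b∉B H⋠g
      (ℕ.≤-trans (subst (_≤ k) (ℕ.+-suc (rk B) t) B+t<k) k≤n)
    excluded : ∀ {K} → b ∈ I ⊎ J ≼ hyp g → ¬ b ∈ K → ¬ K ≼ hyp g → ¬ (I ≼ K × K ≼ J)
    excluded (inj₁ b∈I) b∉K K⋠g (I≼K , K≼J) = b∉K (≼⇒⊆ I≼K b∈I)
    excluded (inj₂ J≼g) b∉K K⋠g (I≼K , K≼J) = K⋠g (≼-trans K≼J J≼g)

  -- If all copoints above `U` contained `p`, then `U` and `U ▹ p` would lie below equally many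
  -- copoints, against `cosize`.
  separate : ∀ {U p} → ¬ p ∈ U → ∃ λ g → U ≼ hyp g × ¬ p ∈ hyp g
  separate {U} {p} p∉U with any? (λ g → (U ≼? hyp g) ×-dec ¬? (p ∈? hyp g))
  ... | yes found = found
  ... | no none   = contradiction
    (κ-cancel (subst₂ _≤_ (cosize U) (cosize (U ▹ p)) (count-mono-≤ _ _ λ g U≼g →
      does-T (U ▹ p ≼? hyp g) (▹-least (T-does (U ≼? hyp g) U≼g)
        (decidable-stable (p ∈? hyp g) λ p∉g → none (g , T-does (U ≼? hyp g) U≼g , p∉g))))))
    (ℕ.<⇒≱ (ℕ.∸-monoʳ-< (subst (rk U <_) (sym (rk-▹ p∉U)) ℕ.≤-refl) (rk-≤ (U ▹ p))))

  -- Relative to the interval from `B` to `H`, the last three inequalities say that `t` is at most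
  -- rank of `I` plus corank of `J`, at most the rank of the layer, and at most its corank. Each
  -- step shrinks the block at both ends and lowers `t` by one.
  annihilator : ∀ t {B I J H} → B ≼ I → I ≼ J → J ≼ H → rk I ≤ k → k ≤ rk J →
    rk B + rk J + t ≤ rk I + rk H → rk B + t ≤ k → k + t ≤ rk H → Annihilator t B I J H
  annihilator zero {B} {I} {J} {H} B≼I I≼J J≼H I≤k k≤J ij B≤k k≤H =
    let (K , K:k , I≼K , K≼J) = between I≼J I≤k k≤J in
    -- No `S` above `B` has rank below `rk B`, so evaluation at one member of the interval suffices.
    δ (K , K:k , ≼-trans B≼I I≼K , ≼-trans K≼J J≼H) ,
    (λ S B≼S S≼H S<B → contradiction (rk-mono B≼S)
      (ℕ.<⇒≱ (subst (rk S <_) (ℕ.+-identityʳ (rk B)) S<B))) ,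
    ind-yes ((I ≼? K) ×-dec (K ≼? J)) (I≼K , K≼J)
  annihilator (suc t) {B} {I} {J} {H} B≼I I≼J J≼H I≤k k≤J ij B≤k k≤H =
    cases (ℕ.m≤n⇒m<n∨m≡n (rk-mono B≼I)) (ℕ.m≤n⇒m<n∨m≡n k≤J)
    where
    k≤n : k ≤ rkV
    k≤n = ℕ.≤-trans k≤J (rk-≤ J)

    B<k : rk B < k
    B<k = ℕ.<-≤-trans (ℕ.m<m+n (rk B) (s≤s z≤n)) B≤k

    B▹+t≤k : ∀ {b} → ¬ b ∈ B → rk (B ▹ b) + t ≤ k
    B▹+t≤k b∉B = subst (_≤ k) (trans (ℕ.+-suc (rk B) t) (cong (_+ t) (sym (rk-▹ b∉B)))) B≤k

    H′: : ∀ {p g} → p ∈ H → ¬ p ∈ hyp g → rk H ≡ suc (rk (H ∩ hyp g))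
    H′: = rk-∩-hyp

    k+t≤H′ : ∀ {p g} → p ∈ H → ¬ p ∈ hyp g → k + t ≤ rk (H ∩ hyp g)
    k+t≤H′ p∈H p∉g = ℕ.s≤s⁻¹ (subst₂ _≤_ (ℕ.+-suc k t) (H′: p∈H p∉g) k≤H)

    -- With `b` in `I` and a copoint above `I` cutting both `J` and `H`, the relative rank of `I`
    -- drops by one and the relative corank of `J` is unchanged.
    shrink-I-and-J : rk B < rk I → k < rk J → Annihilator (suc t) B I J H
    shrink-I-and-J B<I k<J = annihilator-step B≼I I≼J J≼H B≤k k≤n (≼⇒⊆ I≼J b∈I) (≼⇒⊆ I≼g b∈I) b∉B I≼g
      (λ H≼g → p∉g (≼⇒⊆ H≼g (≼⇒⊆ J≼H p∈J))) (inj₁ b∈I)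
      (λ _ L≼H′ → (λ (I≼L , L≼J) → I≼L , ∩-greatest L≼J (≼-trans L≼H′ ∩-≼ʳ)) ,
                  (λ (I≼L , L≼J′) → I≼L , ≼-trans L≼J′ ∩-≼ˡ))
      (annihilator t (▹-least B≼I b∈I) (∩-greatest I≼J I≼g) (∩-greatest (≼-trans ∩-≼ˡ J≼H) ∩-≼ʳ)
        I≤k (ℕ.s≤s⁻¹ (subst (k <_) J′: k<J)) ij′ (B▹+t≤k b∉B) (k+t≤H′ (≼⇒⊆ J≼H p∈J) p∉g))
      where
      b = proj₁ (rk-< B<I)
      b∈I = proj₁ (proj₂ (rk-< B<I))
      b∉B = proj₂ (proj₂ (rk-< B<I))
      I<J = ℕ.≤-<-trans I≤k k<J
      p = proj₁ (rk-< I<J)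
      p∈J = proj₁ (proj₂ (rk-< I<J))
      p∉I = proj₂ (proj₂ (rk-< I<J))
      g = proj₁ (separate p∉I)
      I≼g = proj₁ (proj₂ (separate p∉I))
      p∉g = proj₂ (proj₂ (separate p∉I))
      J′: : rk J ≡ suc (rk (J ∩ hyp g))
      J′: = rk-∩-hyp p∈J p∉g
      ij′ : rk (B ▹ b) + rk (J ∩ hyp g) + t ≤ rk I + rk (H ∩ hyp g)
      ij′ rewrite rk-▹ b∉B = ℕ.s≤s⁻¹ (subst₂ _≤_
        (trans (cong (λ j → rk B + j + suc t) J′:) (trans (ℕ.+-suc _ t) (cong (λ x → suc (x + t)) (ℕ.+-suc (rk B) _))))
        (trans (cong (rk I +_) (H′: (≼⇒⊆ J≼H p∈J) p∉g)) (ℕ.+-suc (rk I) _)) ij)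

    -- The copoint is chosen above `J`, so only `H` is cut. The bottom `I′` may grow by `b`, since
    -- every member of the new block contains `b`.
    shrink-H : ∀ {b I′} → rk J + suc t ≤ rk H → b ∈ J → ¬ b ∈ B → B ▹ b ≼ I′ → I ≼ I′ → I′ ≼ J →
      rk I′ ≤ k → (∀ {L} → B ▹ b ≼ L → I ≼ L → I′ ≼ L) → Annihilator (suc t) B I J H
    shrink-H {b} {I′} J+t<H b∈J b∉B Bb≼I′ I≼I′ I′≼J I′≤k I≼⇒I′≼ =
      annihilator-step B≼I I≼J J≼H B≤k k≤n b∈J (≼⇒⊆ J≼g b∈J) b∉B (≼-trans I≼J J≼g)
      (λ H≼g → p∉g (≼⇒⊆ H≼g p∈H)) (inj₂ J≼g)
      (λ Bb≼L L≼H′ → (λ (I≼L , L≼J) → I≼⇒I′≼ Bb≼L I≼L , L≼J) , (λ (I′≼L , L≼J) → ≼-trans I≼I′ I′≼L , L≼J))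
      (annihilator t Bb≼I′ I′≼J (∩-greatest J≼H J≼g) I′≤k k≤J
        (subst (_≤ rk I′ + rk (H ∩ hyp g)) (sym (ℕ.+-assoc (rk (B ▹ b)) (rk J) t))
          (ℕ.+-mono-≤ (rk-mono Bb≼I′) (ℕ.s≤s⁻¹ (subst₂ _≤_ (ℕ.+-suc (rk J) t) (H′: p∈H p∉g) J+t<H))))
        (B▹+t≤k b∉B) (k+t≤H′ p∈H p∉g))
      where
      J<H = ℕ.<-≤-trans (ℕ.m<m+n (rk J) (s≤s z≤n)) J+t<H
      p = proj₁ (rk-< J<H)
      p∈H = proj₁ (proj₂ (rk-< J<H))
      p∉J = proj₂ (proj₂ (rk-< J<H))
      g = proj₁ (separate p∉J)
      J≼g = proj₁ (proj₂ (separate p∉J))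
      p∉g = proj₂ (proj₂ (separate p∉J))

    cases : rk B < rk I ⊎ rk B ≡ rk I → k < rk J ⊎ k ≡ rk J → Annihilator (suc t) B I J H
    cases (inj₁ B<I) (inj₁ k<J) = shrink-I-and-J B<I k<J
    -- `J` cannot shrink below rank `k`, but `k + suc t ≤ rk H` leaves enough room above it.
    cases (inj₁ B<I) (inj₂ k≡J) = let (b , b∈I , b∉B) = rk-< B<I in
      shrink-H (subst (λ r → r + suc t ≤ rk H) k≡J k≤H) (≼⇒⊆ I≼J b∈I) b∉B
        (▹-least B≼I b∈I) ≼-refl I≼J I≤k (λ _ I≼L → I≼L)
    -- With `I` equal to `B`, no `b` can come from `I`; it is taken from `J`, and `I` is replaced by
    -- `B ▹ b`. The room above `J` comes from `ij`.
    cases (inj₂ B≡I) _ = let (b , b∈J , b∉B) = rk-< (ℕ.<-≤-trans B<k k≤J) in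
      shrink-H (ℕ.+-cancelˡ-≤ (rk I) _ _ (subst (_≤ rk I + rk H)
          (trans (cong (λ i → i + rk J + suc t) B≡I) (ℕ.+-assoc (rk I) (rk J) (suc t))) ij))
        b∈J b∉B ≼-refl (≼-trans I≼B ≼-▹) (▹-least (≼-trans B≼I I≼J) b∈J)
        (subst (_≤ k) (sym (rk-▹ b∉B)) B<k) (λ Bb≼L _ → Bb≼L)
      where
      I≼B : I ≼ B
      I≼B = ≼-rk B≼I (ℕ.≤-reflexive (sym B≡I))

-- Passing to real coefficients

Null : (ℕ → ℚ) → Set
Null u = ∀ ε → 0ℚ ℚ.< ε → ∃ λ N → ∀ n → N ≤ n → ℚ.∣ u n ∣ ℚ.≤ ε

null-0 : Null (λ _ → 0ℚ)
null-0 ε 0<ε = 0 , λ _ _ → ℚ.<⇒≤ 0<ε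

null-cong : ∀ {u v} → (∀ n → u n ≡ v n) → Null u → Null v
null-cong u≗v null ε 0<ε = let (N , small) = null ε 0<ε in
  N , λ n N≤n → subst (λ y → ℚ.∣ y ∣ ℚ.≤ ε) (u≗v n) (small n N≤n)

null-+ : ∀ {u v} → Null u → Null v → Null (λ n → u n ℚ.+ v n)
null-+ {u} {v} null-u null-v ε 0<ε =
  let (M , small-u) = null-u (½ ℚ.* ε) 0<½ε
      (N , small-v) = null-v (½ ℚ.* ε) 0<½ε
  in M ℕ.⊔ N , λ n M⊔N≤n → ℚ.≤-trans (ℚ.∣p+q∣≤∣p∣+∣q∣ (u n) (v n))
    (subst (ℚ.∣ u n ∣ ℚ.+ ℚ.∣ v n ∣ ℚ.≤_) (trans (sym (ℚ.*-distribʳ-+ ε ½ ½)) (ℚ.*-identityˡ ε))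
      (ℚ.+-mono-≤ (small-u n (ℕ.m⊔n≤o⇒m≤o M N M⊔N≤n)) (small-v n (ℕ.m⊔n≤o⇒n≤o M N M⊔N≤n))))
  where
  0<½ε : 0ℚ ℚ.< ½ ℚ.* ε
  0<½ε = ℚ.positive⁻¹ (½ ℚ.* ε)
    where instance
      _ = ℚ.positive 0<ε
      _ = ℚ.pos*pos⇒pos ½ ε

null-* : ∀ a {u} → Null u → Null (λ n → a ℚ.* u n)
null-* a {u} null ε 0<ε =
  let (N , small) = null (ℚ.1/ B ℚ.* ε) (ℚ.positive⁻¹ (ℚ.1/ B ℚ.* ε))
  in N , λ n N≤n → begin
    ℚ.∣ a ℚ.* u n ∣          ≡⟨ ℚ.∣p*q∣≡∣p∣*∣q∣ a (u n) ⟩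
    ℚ.∣ a ∣ ℚ.* ℚ.∣ u n ∣    ≤⟨ ℚ.*-monoʳ-≤-nonNeg ℚ.∣ u n ∣ {{ℚ.nonNegative (ℚ.0≤∣p∣ (u n))}} ∣a∣≤B ⟩
    B ℚ.* ℚ.∣ u n ∣          ≤⟨ ℚ.*-monoˡ-≤-nonNeg B (small n N≤n) ⟩
    B ℚ.* (ℚ.1/ B ℚ.* ε)     ≡⟨ ℚ.*-assoc B (ℚ.1/ B) ε ⟨
    B ℚ.* ℚ.1/ B ℚ.* ε       ≡⟨ cong (ℚ._* ε) (ℚ.*-inverseʳ B) ⟩
    1ℚ ℚ.* ε                 ≡⟨ ℚ.*-identityˡ ε ⟩
    ε ∎
  where
  open ℚ.≤-Reasoning
  B = ℚ.∣ a ∣ ℚ.+ 1ℚ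
  ∣a∣≤B : ℚ.∣ a ∣ ℚ.≤ B
  ∣a∣≤B = subst (ℚ._≤ B) (ℚ.+-identityʳ ℚ.∣ a ∣) (ℚ.+-monoʳ-≤ ℚ.∣ a ∣ (ℚ.<⇒≤ 0<1))
  instance
    pos-B   = ℚ.positive (ℚ.+-mono-≤-< (ℚ.0≤∣p∣ a) 0<1)
    nn-B    = ℚ.pos⇒nonNeg B {{pos-B}}
    nz-B    = ℚ.pos⇒nonZero B {{pos-B}}
    pos-1/B = ℚ.1/pos⇒pos B {{pos-B}}
    pos-ε   = ℚ.positive 0<ε
    pos-δ   = ℚ.pos*pos⇒pos (ℚ.1/ B) {{pos-1/B}} ε {{pos-ε}}

null-eval : ∀ {X : Set} (t : Lin X) {e : X → ℕ → ℚ} → (∀ x → Null (e x)) → Null (λ n → eval t (λ x → e x n))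
null-eval O       null = null-0
null-eval (δ x)   null = null x
null-eval (t ⊕ u) null = null-+ (null-eval t null) (null-eval u null)
null-eval (a ⊙ t) null = null-* a (null-eval t null)

¬null-1 : ¬ Null (λ _ → 1ℚ)
¬null-1 null = let (N , small) = null ½ (ℚ.positive⁻¹ ½) in 1≰½ (small N ℕ.≤-refl)
  where
  1≰½ : ¬ 1ℚ ℚ.≤ ½
  1≰½ (ℚ.*≤* (ℤ.+≤+ (s≤s ())))

≃-pointwise : ∀ {x y : ℝ} → (∀ n → seq x n ≡ seq y n) → x ≃ y
≃-pointwise {x} {y} x≗y ε 0<ε = 0 , λ n _ → subst (λ z → ℚ.∣ z ∣ ℚ.≤ ε)
  (sym (trans (cong (ℚ._- seq y n) (x≗y n)) (ℚ.+-inverseʳ (seq y n)))) (ℚ.<⇒≤ 0<ε)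

seq-ind : ∀ {P : Set} (d : Dec P) n → seq (if does d then 1ℝ else 0ℝ) n ≡ ind d
seq-ind (yes _) n = refl
seq-ind (no _)  n = refl

-- The degree of an interval in a geometry with points and copoints.

module DegreeTheorem {G : Geometry} {X : Pointed G} (Y : Copointed X) where

  open Pointed X
  open Copointed Y
  open Interval Y
  open Degree G using (Layer; χ; x; V̄; IsZero; SetHasDegree; ℱ?)

  combinationℝ : ∀ {k i} → List (ℝ × Layer i) → Layer k → ℝ
  combinationℝ {k} cs K = sumℝ (map (λ (c , I) → c *ℝ x (proj₁ I) k K) cs)

  flatten : ∀ {i} → Lin (Layer i) → List (ℝ × Layer i)
  flatten O       = []
  flatten (δ I)   = (1ℝ , I) ∷ []
  flatten (t ⊕ u) = flatten t ++ flatten u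
  flatten (a ⊙ t) = map (λ (c , I) → fromℚ a *ℝ c , I) (flatten t)

  seq-combinationℝ-++ : ∀ {k i} (cs ds : List (ℝ × Layer i)) (K : Layer k) n →
    seq (combinationℝ (cs ++ ds) K) n ≡ seq (combinationℝ cs K) n ℚ.+ seq (combinationℝ ds K) n
  seq-combinationℝ-++ []       ds K n = sym (ℚ.+-identityˡ _)
  seq-combinationℝ-++ ((c , I) ∷ cs) ds K n = trans
    (cong (seq (c *ℝ x (proj₁ I) _ K) n ℚ.+_) (seq-combinationℝ-++ cs ds K n))
    (sym (ℚ.+-assoc (seq (c *ℝ x (proj₁ I) _ K) n) (seq (combinationℝ cs K) n) (seq (combinationℝ ds K) n)))

  seq-combinationℝ-* : ∀ {k i} a (cs : List (ℝ × Layer i)) (K : Layer k) n →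
    seq (combinationℝ (map (λ (c , I) → fromℚ a *ℝ c , I) cs) K) n ≡ a ℚ.* seq (combinationℝ cs K) n
  seq-combinationℝ-* a []       K n = sym (ℚ.*-zeroʳ a)
  seq-combinationℝ-* a ((c , I) ∷ cs) K n = trans
    (cong₂ ℚ._+_ (ℚ.*-assoc a (seq c n) (seq (x (proj₁ I) _ K) n)) (seq-combinationℝ-* a cs K n))
    (sym (ℚ.*-distribˡ-+ a (seq c n ℚ.* seq (x (proj₁ I) _ K) n) (seq (combinationℝ cs K) n)))

  seq-flatten : ∀ {k i} (t : Lin (Layer i)) (K : Layer k) n →
    seq (combinationℝ (flatten t) K) n ≡ eval t (λ I → χ[ proj₁ I ] (proj₁ K))
  seq-flatten O       K n = refl
  seq-flatten (δ I)   K n = trans (ℚ.+-identityʳ _) (trans (ℚ.*-identityˡ _) (seq-ind (proj₁ I ≼? proj₁ K) n))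
  seq-flatten (t ⊕ u) K n = trans (seq-combinationℝ-++ (flatten t) (flatten u) K n)
    (cong₂ ℚ._+_ (seq-flatten t K n) (seq-flatten u K n))
  seq-flatten (a ⊙ t) K n = trans (seq-combinationℝ-* a (flatten t) K n) (cong (a ℚ.*_) (seq-flatten t K n))

  span⇒V̄ : ∀ {k i I J} → Span k i (χ[ I ⋯ J ] ∘ proj₁) → V̄ i k (χ (ℱ? k I J))
  span⇒V̄ {k} {i} {I} {J} (t , t≡) = flatten t , λ K → ≃-pointwise
    {χ (ℱ? k I J) K} {combinationℝ (flatten t) K}
    λ n → trans (seq-ind (ℱ? k I J K) n) (trans (sym (t≡ K)) (sym (seq-flatten t K n)))

  -- The rational functional is applied to the `n`-th approximations of `χ` minus its supposed
  -- combination. The result is 1 for every `n`, because `φ` annihilates each `χ[ S ]` whatever its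
  -- coefficient, yet it must tend to zero.
  annihilated : ∀ {k s t I J} → LowerBound.Annihilator Y k t ⊥ I J ⊤ → s < t → ¬ V̄ s k (χ (ℱ? k I J))
  annihilated {k} {s} {t} {I} {J} (φ , φ≡0 , φ≡1) s<t (cs , χ≃) =
    ¬null-1 (null-cong difference (null-eval φ λ K → error-null (layer K)))
    where
    open LowerBound Y k using (Block)
    layer : Block ⊥ ⊤ → Layer k
    layer (K , K:k , _) = K , subst (HasRank K) K:k (hasRank K)
    error : Layer k → ℕ → ℚ
    error K n = seq (χ (ℱ? k I J) K) n ℚ.- seq (combinationℝ cs K) n
    error-null : ∀ K → Null (error K)
    error-null K = χ≃ K
    vanishing : ∀ cs n → eval φ (λ K → seq (combinationℝ cs (layer K)) n) ≡ 0ℚ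
    vanishing [] n = trans (eval-* φ 0ℚ (λ _ → 0ℚ)) (ℚ.*-zeroˡ (eval φ λ _ → 0ℚ))
    vanishing ((c , S , S:s) ∷ cs) n = trans
      (eval-+ φ (λ K → seq (c *ℝ x S k (layer K)) n) (λ K → seq (combinationℝ cs (layer K)) n))
      (cong₂ ℚ._+_
        (trans (eval-cong φ λ K → cong (seq c n ℚ.*_) (seq-ind (S ≼? proj₁ K) n))
          (trans (eval-* φ (seq c n) (χ[ S ] ∘ proj₁))
            (trans (cong (seq c n ℚ.*_) (φ≡0 S ⊥-least ⊤-great S<t)) (ℚ.*-zeroʳ (seq c n)))))
        (vanishing cs n))
      where
      S<t : rk S < rk ⊥ + t
      S<t = subst₂ (λ a b → a < b + t) (sym (rk-unique S:s)) (sym rk-⊥) s<t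
    difference : ∀ n → eval φ (λ K → error (layer K) n) ≡ 1ℚ
    difference n = begin
      eval φ (λ K → error (layer K) n)
        ≡⟨ eval-cong φ (λ K → cong₂ ℚ._+_ (seq-ind (ℱ? k I J (layer K)) n) (-1* (seq (combinationℝ cs (layer K)) n))) ⟩
      eval φ (λ K → χ[ I ⋯ J ] (proj₁ K) ℚ.+ (ℚ.- 1ℚ) ℚ.* seq (combinationℝ cs (layer K)) n)
        ≡⟨ eval-+ φ (χ[ I ⋯ J ] ∘ proj₁) (λ K → (ℚ.- 1ℚ) ℚ.* seq (combinationℝ cs (layer K)) n) ⟩
      eval φ (χ[ I ⋯ J ] ∘ proj₁) ℚ.+ eval φ (λ K → (ℚ.- 1ℚ) ℚ.* seq (combinationℝ cs (layer K)) n)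
        ≡⟨ cong₂ ℚ._+_ φ≡1 (trans (eval-* φ (ℚ.- 1ℚ) (λ K → seq (combinationℝ cs (layer K)) n)) (cong ((ℚ.- 1ℚ) ℚ.*_) (vanishing cs n))) ⟩
      1ℚ ∎
      where
      open ≡-Reasoning
      -1* : ∀ y → ℚ.- y ≡ (ℚ.- 1ℚ) ℚ.* y
      -1* y = solve 1 (λ y → :- y := (:- con 1ℚ) :* y) refl y
        where open +-*-Solver

  degree : ∀ k → k ≤ rkV → ∀ I J → I ≼ J → ∀ i r → HasRank I i → HasRank J r →
    SetHasDegree (ℱ? k I J)
      (if does ((k ℕ.<? i) ⊎-dec (rkV ∸ k ℕ.<? rkV ∸ r))
       then ⊥₋ else [ (i + (rkV ∸ r)) ⊓ k ⊓ (rkV ∸ k) ])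
  degree k k≤n I J I≼J i r I:i J:r = go ((k ℕ.<? i) ⊎-dec (n ∸ k ℕ.<? n ∸ r))
    where
    n = rkV
    j = n ∸ r
    t = (i + j) ⊓ k ⊓ (n ∸ k)
    rkI : rk I ≡ i
    rkI = rk-unique I:i
    rkJ : rk J ≡ r
    rkJ = rk-unique J:r
    r≤n : r ≤ n
    r≤n = subst (_≤ n) rkJ (rk-≤ J)
    r+j : r + j ≡ n
    r+j = ℕ.m+[n∸m]≡n r≤n

    zero-if-empty : (∀ K → ¬ (I ≼ proj₁ K × proj₁ K ≼ J)) → IsZero (χ (ℱ? k I J))
    zero-if-empty empty K = ≃-pointwise {χ (ℱ? k I J) K} {0ℝ}
      λ n → trans (seq-ind (ℱ? k I J K) n) (ind-no (ℱ? k I J K) (empty K))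

    empty : k < i ⊎ n ∸ k < n ∸ r → ∀ K → ¬ (I ≼ proj₁ K × proj₁ K ≼ J)
    empty (inj₁ k<i) (K , K:k) (I≼K , _) = ℕ.<⇒≱ k<i (subst₂ _≤_ rkI (rk-unique K:k) (rk-mono I≼K))
    empty (inj₂ n-k<j) (K , K:k) (_ , K≼J) = ℕ.<⇒≱ n-k<j
      (ℕ.∸-monoʳ-≤ n (subst₂ _≤_ (rk-unique K:k) rkJ (rk-mono K≼J)))

    go : (d : Dec (k < i ⊎ n ∸ k < n ∸ r)) → SetHasDegree (ℱ? k I J) (if does d then ⊥₋ else [ t ])
    go (yes out) = zero-if-empty (empty out)
    go (no ¬out) = nonzero , t≤m , span⇒V̄ upper , λ s s≤m s∈ → ℕ.≮⇒≥ λ s<t → annihilated lower s<t s∈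
      where
      i≤k : rk I ≤ k
      i≤k = subst (_≤ k) (sym rkI) (ℕ.≮⇒≥ (¬out ∘ inj₁))
      k≤r : k ≤ rk J
      k≤r = subst (k ≤_) (sym rkJ) (ℕ.≮⇒≥ λ r<k → ¬out (inj₂ (ℕ.∸-monoʳ-< r<k k≤n)))
      t≤i+j : t ≤ i + j
      t≤i+j = ℕ.≤-trans (ℕ.m⊓n≤m ((i + j) ⊓ k) (n ∸ k)) (ℕ.m⊓n≤m (i + j) k)
      t≤k : t ≤ k
      t≤k = ℕ.≤-trans (ℕ.m⊓n≤m ((i + j) ⊓ k) (n ∸ k)) (ℕ.m⊓n≤n (i + j) k)
      t≤n-k : t ≤ n ∸ k
      t≤n-k = ℕ.m⊓n≤n ((i + j) ⊓ k) (n ∸ k)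
      t≤m : t ≤ k ⊓ (n ∸ k)
      t≤m = ℕ.⊓-glb t≤k t≤n-k
      nonzero : ¬ IsZero (χ (ℱ? k I J))
      nonzero isZero =
        let (K , K:k , I≼K , K≼J) = between I≼J i≤k k≤r
            K′ = K , subst (HasRank K) K:k (hasRank K)
        in ¬null-1 (null-cong (λ n → trans (ℚ.+-identityʳ _)
             (trans (seq-ind (ℱ? k I J K′) n) (ind-yes (ℱ? k I J K′) (I≼K , K≼J)))) (isZero K′))
      upper : Span k t (χ[ I ⋯ J ] ∘ proj₁)
      upper = subst (λ i → Span k ((i + j) ⊓ k ⊓ (n ∸ k)) (χ[ I ⋯ J ] ∘ proj₁)) rkI
        (span-interval-⊓ k I≼J i≤k k≤n (trans (cong (_+ j) rkJ) r+j))
      -- On the block from `⊥` to `⊤` the three inequalities become `t ≤ i + j`, `t ≤ k` and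
      -- `t ≤ n ∸ k`.
      lower : LowerBound.Annihilator Y k t ⊥ I J ⊤
      lower = LowerBound.annihilator Y k t ⊥-least I≼J ⊤-great i≤k k≤r
        (subst₂ _≤_ (cong₂ (λ a b → a + b + t) (sym rk-⊥) (sym rkJ)) (cong₂ _+_ (sym rkI) (sym rk-⊤))
          (ℕ.≤-trans (ℕ.+-monoʳ-≤ r t≤i+j) (ℕ.≤-reflexive
            (trans (sym (ℕ.+-assoc r i j)) (trans (cong (_+ j) (ℕ.+-comm r i)) (trans (ℕ.+-assoc i r j) (cong (i +_) r+j)))))))
        (subst (λ z → z + t ≤ k) (sym rk-⊥) t≤k)
        (subst (k + t ≤_) (trans (ℕ.m+[n∸m]≡n k≤n) (sym rk-⊤)) (ℕ.+-monoʳ-≤ k t≤n-k))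

-- Subsets of a finite set

count-cong : ∀ {N} {P Q : Fin N → Bool} → (∀ i → P i ≡ Q i) → count P ≡ count Q
count-cong {zero}  P≗Q = refl
count-cong {suc N} P≗Q = cong₂ _+_ (cong (if_then 1 else 0) (P≗Q zero)) (count-cong (P≗Q ∘ suc))

count-false : ∀ N → count {N} (λ _ → false) ≡ 0
count-false zero    = refl
count-false (suc N) = count-false N

count-true : ∀ N → count {N} (λ _ → true) ≡ N
count-true zero    = refl
count-true (suc N) = cong suc (count-true N)

count-not : ∀ {N} (P : Fin N → Bool) → count (not ∘ P) ≡ N ∸ count P
count-not P = trans (sym (ℕ.m+n∸n≡m _ (count P))) (cong (_∸ count P) (total P))
  where
  total : ∀ {N} (P : Fin N → Bool) → count (not ∘ P) + count P ≡ N
  total {zero}  P = refl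
  total {suc N} P with P zero
  ... | true  = trans (ℕ.+-suc _ _) (cong suc (total (P ∘ suc)))
  ... | false = cong suc (total (P ∘ suc))

count-insert : ∀ {N} (P Q : Fin N → Bool) p → ¬ T (P p) → T (Q p) →
  (∀ i → i ≢ p → P i ≡ Q i) → count Q ≡ suc (count P)
count-insert P Q zero ¬Pp Qp P≗Q with P zero | Q zero
... | true  | _     = contradiction _ ¬Pp
... | false | true  = cong suc (sym (count-cong λ i → P≗Q (suc i) λ ()))
count-insert P Q (suc p) ¬Pp Qp P≗Q = trans
  (cong₂ _+_ (cong (if_then 1 else 0) (sym (P≗Q zero λ ())))
    (count-insert (P ∘ suc) (Q ∘ suc) p ¬Pp Qp λ i i≢p → P≗Q (suc i) λ { refl → i≢p refl }))
  (ℕ.+-suc _ _)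

enumerate : ∀ {N} (P : Fin N → Bool) → (∃ λ i → T (P i)) ↔ Fin (count P)
enumerate {zero}  P = mk↔ₛ′ proj₁ (λ ()) (λ ()) (λ ())
enumerate {suc N} P = ↔-trans split (↔-trans (bit (P zero) ⊎-↔ enumerate (P ∘ suc)) (↔-sym +↔⊎))
  where
  split : (∃ λ i → T (P i)) ↔ (T (P zero) ⊎ ∃ λ i → T (P (suc i)))
  split = mk↔ₛ′ (λ { (zero , t) → inj₁ t ; (suc i , t) → inj₂ (i , t) })
    (λ { (inj₁ t) → zero , t ; (inj₂ (i , t)) → suc i , t })
    (λ { (inj₁ t) → refl ; (inj₂ (i , t)) → refl })
    (λ { (zero , t) → refl ; (suc i , t) → refl })
  bit : ∀ b → T b ↔ Fin (if b then 1 else 0)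
  bit true  = mk↔ₛ′ (λ _ → zero) (λ _ → _) (λ { zero → refl }) (λ _ → refl)
  bit false = mk↔ₛ′ (λ ()) (λ ()) (λ ()) (λ ())

does-≡ : ∀ {P : Set} (d : Dec P) {b} → (P → T b) → (T b → P) → does d ≡ b
does-≡ (yes p) {true}  f g = refl
does-≡ (yes p) {false} f g = ⊥-elim (f p)
does-≡ (no ¬p) {true}  f g = contradiction (g _) ¬p
does-≡ (no ¬p) {false} f g = refl

≡-T : ∀ {b c} → (T b → T c) → (T c → T b) → b ≡ c
≡-T {true}  {true}  f g = refl
≡-T {true}  {false} f g = ⊥-elim (f _)
≡-T {false} {true}  f g = ⊥-elim (g _)
≡-T {false} {false} f g = refl

T-not⁻ : ∀ {b} → T (not b) → ¬ T b
T-not⁻ {false} _ ()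

T-not⁺ : ∀ {b} → ¬ T b → T (not b)
T-not⁺ {true}  ¬t = ¬t _
T-not⁺ {false} _  = _

module SetGeometry (A : Set) (n : ℕ) (A↔Fin : A ↔ Fin n) where

  open FiniteSet A n A↔Fin
  open Inverse A↔Fin using (to; from; strictlyInverseˡ; strictlyInverseʳ)

  card : Subset → ℕ
  card U = count (U ∘ from)

  add : Subset → Fin n → Subset
  add U p a = U a ∨ does (to a ≟ p)

  ∈-add⁻ : ∀ U p a → T (add U p a) → T (U a) ⊎ to a ≡ p
  ∈-add⁻ U p a t with Equivalence.to (T-∨ {U a}) t
  ... | inj₁ a∈U = inj₁ a∈U
  ... | inj₂ a≡p = inj₂ (T-does (to a ≟ p) a≡p)

  ∈-add⁺ : ∀ U p a → T (U a) ⊎ to a ≡ p → T (add U p a)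
  ∈-add⁺ U p a (inj₁ a∈U) = Equivalence.from (T-∨ {U a}) (inj₁ a∈U)
  ∈-add⁺ U p a (inj₂ a≡p) = Equivalence.from (T-∨ {U a}) (inj₂ (does-T (to a ≟ p) a≡p))

  members : ∀ U → (∃ λ a → T (U a)) ↔ Fin (card U)
  members U = ↔-trans reindex (enumerate (U ∘ from))
    where
    reindex : (∃ λ a → T (U a)) ↔ (∃ λ i → T (U (from i)))
    reindex = mk↔ₛ′
      (λ (a , t) → to a , subst (T ∘ U) (sym (strictlyInverseʳ a)) t)
      (λ (i , t) → from i , t)
      (λ (i , t) → pair (T ∘ U ∘ from) T-irrelevant (strictlyInverseˡ i))
      (λ (a , t) → pair (T ∘ U) T-irrelevant (strictlyInverseʳ a))
      where
      pair : ∀ {B : Set} (P : B → Set) → (∀ {b} (s t : P b) → s ≡ t) →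
        ∀ {b c} {s : P b} {t : P c} → b ≡ c → (b , s) ≡ (c , t)
      pair P irr refl = cong (_ ,_) (irr _ _)

  pointed : Pointed subsets
  pointed = record
    { N       = n
    ; _∈_     = λ p U → T (U (from p))
    ; _∈?_    = λ p U → T? (U (from p))
    ; ≼⇒⊆     = λ U⊆W → U⊆W _
    ; ⊆⇒≼     = λ {U} {W} h a → subst (λ b → T (U b) → T (W b)) (strictlyInverseʳ a) (h (to a))
    ; ⊥       = λ _ → false
    ; ⊤       = λ _ → true
    ; ⊥-least = λ _ ()
    ; ⊤-great = λ _ _ → _
    ; _▹_     = add
    ; ∈-▹     = λ {U} {p} → ∈-add⁺ U p (from p) (inj₂ (strictlyInverseˡ p))
    ; ≼-▹     = λ {U} {p} a a∈U → ∈-add⁺ U p a (inj₁ a∈U)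
    ; ▹-least = λ {U} {p} {W} U⊆W p∈W a a∈ → least {U} {p} {W} a (U⊆W a) p∈W (∈-add⁻ U p a a∈)
    ; rk      = card
    ; rk-⊥    = count-false n
    ; rk-⊤    = count-true n
    ; rk-▹    = λ {U} {p} p∉U → count-insert (U ∘ from) (add U p ∘ from) p p∉U
        (∈-add⁺ U p (from p) (inj₂ (strictlyInverseˡ p)))
        λ i i≢p → ≡-T (λ i∈U → ∈-add⁺ U p (from i) (inj₁ i∈U)) (old {U} i i≢p ∘ ∈-add⁻ U p (from i))
    ; κ       = λ r → r
    ; κ-mono  = λ r<s → r<s
    ; size    = λ U → refl
    }
    where
    least : ∀ {U p W} a → (T (U a) → T (W a)) → T (W (from p)) → T (U a) ⊎ to a ≡ p → T (W a)
    least a U⊆W p∈W (inj₁ a∈U) = U⊆W a∈U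
    least {W = W} a U⊆W p∈W (inj₂ refl) = subst (T ∘ W) (strictlyInverseʳ a) p∈W
    old : ∀ {U p} i → i ≢ p → T (U (from i)) ⊎ to (from i) ≡ p → T (U (from i))
    old i i≢p (inj₁ i∈U) = i∈U
    old i i≢p (inj₂ eq)  = contradiction (trans (sym (strictlyInverseˡ i)) eq) i≢p

  copointed : Copointed pointed
  copointed = record
    { hasRank    = members
    ; rk-unique  = λ {U} U:r → ↔⇒≡ (↔-trans (↔-sym (members U)) U:r)
    ; _∩_        = λ U W a → U a ∧ W a
    ; ∩-≼ˡ       = λ {U} a t → proj₁ (Equivalence.to (T-∧ {U a}) t)
    ; ∩-≼ʳ       = λ {U} a t → proj₂ (Equivalence.to (T-∧ {U a}) t)
    ; ∩-greatest = λ {U} X⊆U X⊆W a t → Equivalence.from (T-∧ {U a}) (X⊆U a t , X⊆W a t)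
    ; modular    = λ {U} {W} {p} p∈U U⊆ a a∈U →
        ∈-add⁺ (λ a → U a ∧ W a) p a (modular-law {U} {W} a a∈U (∈-add⁻ W p a (U⊆ a a∈U)))
    ; N′         = n
    ; hyp        = hyperplane
    ; hyp-▹      = λ {g} {p} p∉g a _ → ∈-add⁺ (hyperplane g) p a (cover p∉g a)
    -- A hyperplane contains `U` exactly when the element it omits is off `U`.
    ; cosize     = λ U → trans (count-cong λ g → does-≡ (U ⊆? hyperplane g)
          (λ U⊆g → T-not⁺ λ g∈U → T-not⁻ (U⊆g (from g) g∈U) (does-T (to (from g) ≟ g) (strictlyInverseˡ g)))
          (λ g∉U a a∈U → T-not⁺ λ a≡g → T-not⁻ g∉U
            (subst (T ∘ U) (trans (sym (strictlyInverseʳ a)) (cong from (T-does (to a ≟ g) a≡g))) a∈U)))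
        (count-not (U ∘ from))
    }
    where
    hyperplane : Fin n → Subset
    hyperplane g a = not (does (to a ≟ g))
    modular-law : ∀ {U W p} a → T (U a) → T (W a) ⊎ to a ≡ p → T (U a ∧ W a) ⊎ to a ≡ p
    modular-law {U} a a∈U (inj₁ a∈W) = inj₁ (Equivalence.from (T-∧ {U a}) (a∈U , a∈W))
    modular-law a a∈U (inj₂ a≡p) = inj₂ a≡p
    cover : ∀ {g p} → ¬ T (hyperplane g (from p)) → ∀ a → T (hyperplane g a) ⊎ to a ≡ p
    cover {g} {p} p∉g a with to a ≟ p
    ... | yes a≡p = inj₂ a≡p
    ... | no a≢p  = inj₁ (T-not⁺ λ t → p∉g (T-not⁺ λ s →
      a≢p (trans (T-does (to a ≟ g) t) (trans (sym (T-does (to (from p) ≟ g) s)) (strictlyInverseˡ p)))))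

-- Subspaces of a finite vector space

funToFin-cong : ∀ {m n} {f g : Fin m → Fin n} → (∀ i → f i ≡ g i) → funToFin f ≡ funToFin g
funToFin-cong {zero}  f≗g = refl
funToFin-cong {suc m} f≗g = cong₂ combine (f≗g zero) (funToFin-cong (f≗g ∘ suc))

module VectorGeometry
  (F : HeytingField 0ℓ 0ℓ 0ℓ) (q : ℕ)
  (F↔Fin : Inverse (CommutativeRing.setoid (fieldRing F)) (setoid (Fin q)))
  (M : Module (fieldRing F) 0ℓ 0ℓ) (n : ℕ) (dimM : Linear.HasDim F M (Linear.whole F M) n)
  where

  private
    R = fieldRing F

  open CommutativeRing R using () renaming
    ( Carrier to Scalar; _≈_ to _≈F_; _+_ to _+F_; _*_ to _*F_; -_ to -F_; 0# to 0F; 1# to 1F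
    ; refl to ≈F-refl; sym to ≈F-sym; trans to ≈F-trans; setoid to F-setoid
    ; +-cong to +F-cong; +-congˡ to +F-congˡ; +-identityˡ to +F-identityˡ; +-identityʳ to +F-identityʳ
    ; -‿inverseʳ to -F-inverseʳ
    ; *-cong to *F-cong; *-congˡ to *F-congˡ; *-comm to *F-comm; *-assoc to *F-assoc
    ; *-identityʳ to *F-identityʳ; zeroʳ to *F-zeroʳ; distribˡ to *F-distribˡ; -‿cong to -F-cong )
  open CommutativeSemigroupProperties (CommutativeRing.*-commutativeSemigroup R) using (x∙yz≈y∙xz)
  open RingProperties (CommutativeRing.ring R) using (-1*x≈-x; -‿distribˡ-*)
  open GroupProperties (CommutativeRing.+-group R) using (x∙y⁻¹≈ε⇒x≈y)
  open Module M
  open FiniteVectorSpace F q F↔Fin M n dimM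
  open Inverse F↔Fin using (to; from; to-cong; from-cong; strictlyInverseˡ; strictlyInverseʳ)
  open CommutativeSemigroupProperties (CommutativeMonoid.commutativeSemigroup +ᴹ-commutativeMonoid)
    using (interchange)
  private
    module ΣM = CommutativeMonoidSum +ᴹ-commutativeMonoid
    module ΣF = SemiringSum (CommutativeRing.semiring R)

  _≈?_ : ∀ a b → Dec (a ≈F b)
  a ≈? b = map′ (λ eq → ≈F-trans (≈F-sym (strictlyInverseʳ a)) (≈F-trans (from-cong eq) (strictlyInverseʳ b)))
    to-cong (to a ≟ to b)

  -- A search through the finitely many scalars. If it fails, `a` cannot be apart from `0F`, and
  -- tightness gives `a ≈F 0F`.
  inverse : ∀ {a} → ¬ a ≈F 0F → ∃ λ y → y *F a ≈F 1F
  inverse {a} a≉0 with any? (λ i → (from i *F a) ≈? 1F)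
  ... | yes (i , ia≈1) = from i , ia≈1
  ... | no none = contradiction (proj₁ (HeytingField.tight F a 0F) λ a#0 →
    let (y , y[a-0]≈1 , _) = HeytingField.#⇒invertible F a#0 in
    none (to y , ≈F-trans (*F-cong (strictlyInverseʳ y) (≈F-sym (x-0≈x a))) y[a-0]≈1)) a≉0
    where open HeytingProperties (HeytingField.heytingCommutativeRing F) using (x-0≈x)

  1≉0 : ¬ 1F ≈F 0F
  1≉0 1≈0 = proj₂ (HeytingField.tight F 1F 0F) 1≈0 1#0
    where open HeytingProperties (HeytingField.heytingCommutativeRing F) using (1#0)

  1<q : 1 < q
  1<q = two (to 1F) (to 0F) λ eq → 1≉0 (≈F-trans (≈F-sym (strictlyInverseʳ 1F))
    (≈F-trans (from-cong eq) (strictlyInverseʳ 0F)))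
    where
    two : ∀ {q} (i j : Fin q) → i ≢ j → 1 < q
    two {suc zero}    zero zero i≢j = contradiction refl i≢j
    two {suc (suc q)} _    _    _   = s≤s (s≤s z≤n)

  shift-back : ∀ w s v → (w +ᴹ s *ₗ v) +ᴹ (-F s) *ₗ v ≈ᴹ w
  shift-back w s v = begin
    (w +ᴹ s *ₗ v) +ᴹ (-F s) *ₗ v    ≈⟨ +ᴹ-assoc w (s *ₗ v) ((-F s) *ₗ v) ⟩
    w +ᴹ (s *ₗ v +ᴹ (-F s) *ₗ v)    ≈⟨ +ᴹ-congˡ (*ₗ-distribʳ v s (-F s)) ⟨
    w +ᴹ (s +F (-F s)) *ₗ v         ≈⟨ +ᴹ-congˡ (≈ᴹ-trans (*ₗ-congʳ (-F-inverseʳ s)) (*ₗ-zeroˡ v)) ⟩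
    w +ᴹ 0ᴹ                         ≈⟨ +ᴹ-identityʳ w ⟩
    w                               ∎
    where open SetoidReasoning ≈ᴹ-setoid

  +0* : ∀ w v → w +ᴹ 0F *ₗ v ≈ᴹ w
  +0* w v = ≈ᴹ-trans (+ᴹ-congˡ (*ₗ-zeroˡ v)) (+ᴹ-identityʳ w)

  minus-self : ∀ v → v +ᴹ (-F 1F) *ₗ v ≈ᴹ 0ᴹ
  minus-self v = ≈ᴹ-trans (+ᴹ-cong (≈ᴹ-trans (≈ᴹ-sym (*ₗ-identityˡ v)) (≈ᴹ-sym (+ᴹ-identityˡ (1F *ₗ v)))) ≈ᴹ-refl)
    (shift-back 0ᴹ 1F v)

  unshift : ∀ X {w s v} → T (member X (w +ᴹ s *ₗ v)) → T (member X v) → T (member X w)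
  unshift X {w} {s} {v} w+sv∈X v∈X = resp X (shift-back w s v) (+-mem X w+sv∈X (*ₗ-mem X (-F s) v∈X))

  unscale : ∀ X {a v} → ¬ a ≈F 0F → T (member X (a *ₗ v)) → T (member X v)
  unscale X {a} {v} a≉0 av∈X = let (y , ya≈1) = inverse a≉0 in
    resp X (≈ᴹ-trans (≈ᴹ-sym (*ₗ-assoc y a v)) (≈ᴹ-trans (*ₗ-congʳ ya≈1) (*ₗ-identityˡ v))) (*ₗ-mem X y av∈X)

  module _ {r : ℕ} (u : Fin r → Carrierᴹ) where

    combination-cong : ∀ {c d} → (∀ i → c i ≈F d i) → combination c u ≈ᴹ combination d u
    combination-cong c≈d = ΣM.sum-cong-≋ λ i → *ₗ-congʳ (c≈d i)

    combination-+ : ∀ c d → combination (λ i → c i +F d i) u ≈ᴹ combination c u +ᴹ combination d u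
    combination-+ c d = ≈ᴹ-trans (ΣM.sum-cong-≋ λ i → *ₗ-distribʳ (u i) (c i) (d i))
      (ΣM.∑-distrib-+ (λ i → c i *ₗ u i) (λ i → d i *ₗ u i))

  combination-* : ∀ {r} (u : Fin r → Carrierᴹ) a c → combination (λ i → a *F c i) u ≈ᴹ a *ₗ combination c u
  combination-* {zero}  u a c = ≈ᴹ-sym (*ₗ-zeroʳ a)
  combination-* {suc r} u a c = ≈ᴹ-trans (+ᴹ-cong (*ₗ-assoc a (c zero) (u zero)) (combination-* (u ∘ suc) a (c ∘ suc)))
    (≈ᴹ-sym (*ₗ-distribˡ a (c zero *ₗ u zero) (combination (c ∘ suc) (u ∘ suc))))

  combination-∈ : ∀ X {r} (u : Fin r → Carrierᴹ) c → (∀ i → T (member X (u i))) → T (member X (combination c u))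
  combination-∈ X {zero}  u c u∈X = 0-mem X
  combination-∈ X {suc r} u c u∈X = +-mem X (*ₗ-mem X (c zero) (u∈X zero)) (combination-∈ X (u ∘ suc) (c ∘ suc) (u∈X ∘ suc))

  independent⇒unique : ∀ {U r} {u : Fin r → Carrierᴹ} → IsBasis U u → ∀ {c d} →
    combination c u ≈ᴹ combination d u → ∀ i → c i ≈F d i
  independent⇒unique {u = u} basis {c} {d} eq i = x∙y⁻¹≈ε⇒x≈y (c i) (d i)
    (≈F-trans (+F-congˡ (≈F-sym (-1*x≈-x (d i)))) (IsBasis.independent basis (λ i → c i +F (-F 1F) *F d i) vanish i))
    where
    vanish : combination (λ i → c i +F (-F 1F) *F d i) u ≈ᴹ 0ᴹ
    vanish = ≈ᴹ-trans (combination-+ u c (λ i → (-F 1F) *F d i))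
      (≈ᴹ-trans (+ᴹ-cong eq (combination-* u (-F 1F) d)) (minus-self (combination d u)))

  -- Coordinates and the number of vectors of a subspace.

  module Numbering {U : Subspace} {r : ℕ} (dimU : HasDim U r) where

    open IsBasis (proj₂ dimU)

    basis : Fin r → Carrierᴹ
    basis = proj₁ dimU

    coords : ∀ v → T (member U v) → Fin r → Scalar
    coords v v∈U = proj₁ (spanning v v∈U)

    coords-unique : ∀ {v} v∈U {c} → v ≈ᴹ combination c basis → ∀ i → coords v v∈U i ≈F c i
    coords-unique {v} v∈U v≈ = independent⇒unique (proj₂ dimU) (≈ᴹ-trans (≈ᴹ-sym (proj₂ (spanning v v∈U))) v≈)

    vector : Fin (q ℕ.^ r) → Carrierᴹ
    vector i = combination (λ j → from (finToFun i j)) basis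

    vector-∈ : ∀ i → T (member U (vector i))
    vector-∈ i = combination-∈ U basis _ inside

    number : ∀ v → T (member U v) → Fin (q ℕ.^ r)
    number v v∈U = funToFin (to ∘ coords v v∈U)

    vector-number : ∀ v v∈U → vector (number v v∈U) ≈ᴹ v
    vector-number v v∈U = ≈ᴹ-trans
      (combination-cong basis λ j → ≈F-trans (from-cong (finToFun-funToFin (to ∘ coords v v∈U) j)) (strictlyInverseʳ _))
      (≈ᴹ-sym (proj₂ (spanning v v∈U)))

    number-cong : ∀ {v w} v∈U w∈U → v ≈ᴹ w → number v v∈U ≡ number w w∈U
    number-cong {w = w} v∈U w∈U v≈w = funToFin-cong λ j →
      to-cong (coords-unique v∈U (≈ᴹ-trans v≈w (proj₂ (spanning w w∈U))) j)

    number-vector : ∀ i i∈U → number (vector i) i∈U ≡ i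
    number-vector i i∈U = trans
      (funToFin-cong λ j → trans (to-cong (coords-unique i∈U ≈ᴹ-refl j)) (strictlyInverseˡ (finToFun i j)))
      (funToFin-finToFin {r} {q} i)

  open Numbering dimM using (vector; vector-number) renaming (number-cong to number-congᵂ; number-vector to number-vectorᵂ)

  number : Carrierᴹ → Fin (q ℕ.^ n)
  number v = Numbering.number dimM v tt

  members : ∀ {U r} → HasDim U r → (∃ λ p → T (member U (vector p))) ↔ Fin (q ℕ.^ r)
  members {U} dimU = mk↔ₛ′
    (λ (p , p∈U) → N.number (vector p) p∈U)
    (λ i → number (N.vector i) , resp U (≈ᴹ-sym (vector-number (N.vector i) tt)) (N.vector-∈ i))
    (λ i → trans (N.number-cong _ (N.vector-∈ i) (vector-number (N.vector i) tt)) (N.number-vector i (N.vector-∈ i)))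
    (λ (p , p∈U) → pair (trans (number-congᵂ tt tt (N.vector-number (vector p) p∈U)) (number-vectorᵂ p tt)))
    where
    module N = Numbering dimU
    pair : ∀ {i j : Fin (q ℕ.^ n)} {s : T (member U (vector i))} {t : T (member U (vector j))} →
      i ≡ j → _≡_ {A = ∃ λ p → T (member U (vector p))} (i , s) (j , t)
    pair {i} refl = cong (i ,_) (T-irrelevant _ _)

  size-dim : ∀ {U r} → HasDim U r → count (member U ∘ vector) ≡ q ℕ.^ r
  size-dim {U} dimU = ↔⇒≡ (↔-trans (↔-sym (enumerate (member U ∘ vector))) (members dimU))

  ^-mono : ∀ {r s} → r < s → q ℕ.^ r < q ℕ.^ s
  ^-mono = ℕ.^-monoʳ-< q 1<q

  -- Counting takes the place of the exchange lemma: inclusion gives `q ^ r ≤ q ^ s`, and `1 < q`.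
  dim-mono : ∀ {U W r s} → U ⊆ W → HasDim U r → HasDim W s → r ≤ s
  dim-mono {U} {W} U⊆W dimU dimW = ℕ.≮⇒≥ λ s<r → ℕ.<⇒≱ (^-mono s<r)
    (subst₂ _≤_ (size-dim dimU) (size-dim dimW) (count-mono-≤ (member U ∘ vector) (member W ∘ vector) λ p → U⊆W (vector p)))

  dim-unique : ∀ {U r s} → HasDim U r → HasDim U s → r ≡ s
  dim-unique dimU dimU′ = ℕ.≤-antisym (dim-mono (λ _ t → t) dimU dimU′) (dim-mono (λ _ t → t) dimU′ dimU)

  ≈0? : ∀ v → Dec (v ≈ᴹ 0ᴹ)
  ≈0? v = map′ (λ eq → ≈ᴹ-trans (≈ᴹ-sym (vector-number v tt))
      (≈ᴹ-trans (≈ᴹ-reflexive (cong vector eq)) (vector-number 0ᴹ tt)))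
    (number-congᵂ tt tt) (number v ≟ number 0ᴹ)

  -- Adjoining a vector and the existence of bases.

  zeroSpace : Subspace
  zeroSpace = record
    { member = λ v → does (≈0? v)
    ; resp   = λ {v} {w} v≈w v≈0 → does-T (≈0? w) (≈ᴹ-trans (≈ᴹ-sym v≈w) (T-does (≈0? v) v≈0))
    ; 0-mem  = does-T (≈0? 0ᴹ) ≈ᴹ-refl
    ; +-mem  = λ {v} {w} v≈0 w≈0 → does-T (≈0? (v +ᴹ w))
        (≈ᴹ-trans (+ᴹ-cong (T-does (≈0? v) v≈0) (T-does (≈0? w) w≈0)) (+ᴹ-identityˡ 0ᴹ))
    ; *ₗ-mem = λ c {v} v≈0 → does-T (≈0? (c *ₗ v)) (≈ᴹ-trans (*ₗ-congˡ (T-does (≈0? v) v≈0)) (*ₗ-zeroʳ c))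
    }

  zeroSpace⇒≈0 : ∀ {v} → T (member zeroSpace v) → v ≈ᴹ 0ᴹ
  zeroSpace⇒≈0 {v} = T-does (≈0? v)

  zero-dim : HasDim zeroSpace 0
  zero-dim = (λ ()) , record
    { inside = λ () ; independent = λ _ _ () ; spanning = λ v v≈0 → (λ ()) , zeroSpace⇒≈0 v≈0 }

  module _ (U : Subspace) (v : Carrierᴹ) where

    -- Membership in the span of `U` and `v`, in a form decided by a search through the scalars
    -- alone.
    Shifted : Carrierᴹ → Set
    Shifted w = ∃ λ s → T (member U (w +ᴹ s *ₗ v))

    shifted? : ∀ w → Dec (Shifted w)
    shifted? w = map′ (λ (i , t) → from i , t)
      (λ (s , t) → to s , resp U (+ᴹ-congˡ (*ₗ-congʳ (≈F-sym (strictlyInverseʳ s)))) t)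
      (any? λ i → T? (member U (w +ᴹ from i *ₗ v)))

    adjoin : Subspace
    adjoin = record
      { member = λ w → does (shifted? w)
      ; resp   = λ {w} {w′} w≈w′ t → let (s , w∈) = T-does (shifted? w) t in
          does-T (shifted? w′) (s , resp U (+ᴹ-congʳ w≈w′) w∈)
      ; 0-mem  = does-T (shifted? 0ᴹ) (0F , resp U (≈ᴹ-sym (+0* 0ᴹ v)) (0-mem U))
      ; +-mem  = λ {w} {w′} t t′ →
          let (s , w∈) = T-does (shifted? w) t
              (s′ , w′∈) = T-does (shifted? w′) t′
          in does-T (shifted? (w +ᴹ w′)) (s +F s′ , resp U
               (≈ᴹ-trans (interchange w (s *ₗ v) w′ (s′ *ₗ v)) (+ᴹ-congˡ (≈ᴹ-sym (*ₗ-distribʳ v s s′))))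
               (+-mem U w∈ w′∈))
      ; *ₗ-mem = λ c {w} t → let (s , w∈) = T-does (shifted? w) t in
          does-T (shifted? (c *ₗ w)) (c *F s , resp U
            (≈ᴹ-trans (*ₗ-distribˡ c w (s *ₗ v)) (+ᴹ-congˡ (≈ᴹ-sym (*ₗ-assoc c s v)))) (*ₗ-mem U c w∈))
      }

    ∈-adjoin⁻ : ∀ {w} → T (member adjoin w) → Shifted w
    ∈-adjoin⁻ {w} = T-does (shifted? w)

    ∈-adjoin⁺ : ∀ {w} → Shifted w → T (member adjoin w)
    ∈-adjoin⁺ {w} = does-T (shifted? w)

    ⊆-adjoin : U ⊆ adjoin
    ⊆-adjoin w w∈U = ∈-adjoin⁺ (0F , resp U (≈ᴹ-sym (+0* w v)) w∈U)

    ∈-adjoin : T (member adjoin v)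
    ∈-adjoin = ∈-adjoin⁺ (-F 1F , resp U (≈ᴹ-sym (minus-self v)) (0-mem U))

    adjoin-least : ∀ {W} → U ⊆ W → T (member W v) → adjoin ⊆ W
    adjoin-least {W} U⊆W v∈W w t = let (s , w∈) = ∈-adjoin⁻ t in unshift W (U⊆W _ w∈) v∈W

    adjoin-dim : ∀ {r} → HasDim U r → ¬ T (member U v) → HasDim adjoin (suc r)
    adjoin-dim {r} (u , basis) v∉U = u⁺ , record
      { inside      = λ { zero → ∈-adjoin ; (suc i) → ⊆-adjoin (u i) (IsBasis.inside basis i) }
      ; independent = independent⁺
      ; spanning    = λ w t →
          let (s , w∈) = ∈-adjoin⁻ t
              (c , eq) = IsBasis.spanning basis _ w∈
          in (λ { zero → -F s ; (suc i) → c i }) ,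
             ≈ᴹ-trans (≈ᴹ-sym (shift-back w s v)) (≈ᴹ-trans (+ᴹ-congʳ eq) (+ᴹ-comm _ _))
      }
      where
      u⁺ : Fin (suc r) → Carrierᴹ
      u⁺ zero    = v
      u⁺ (suc i) = u i
      independent⁺ : ∀ c → combination c u⁺ ≈ᴹ 0ᴹ → ∀ i → c i ≈F 0F
      independent⁺ c eq = λ { zero → c₀≈0 ; (suc i) → IsBasis.independent basis (c ∘ suc) tail≈0 i }
        where
        tail = combination (c ∘ suc) u
        -- The rest of the relation lies in `U`, so `c zero *ₗ v` does too; a nonzero coefficient
        -- would put `v` into `U`.
        c₀v∈U : T (member U (c zero *ₗ v))
        c₀v∈U = unshift U (resp U (≈ᴹ-sym (≈ᴹ-trans (+ᴹ-congˡ (*ₗ-identityˡ tail)) eq)) (0-mem U))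
          (combination-∈ U u (c ∘ suc) (IsBasis.inside basis))
        c₀≈0 : c zero ≈F 0F
        c₀≈0 with c zero ≈? 0F
        ... | yes eq₀ = eq₀
        ... | no c₀≉0 = contradiction (unscale U c₀≉0 c₀v∈U) v∉U
        tail≈0 : tail ≈ᴹ 0ᴹ
        tail≈0 = ≈ᴹ-trans (≈ᴹ-sym (≈ᴹ-trans (+ᴹ-congʳ (≈ᴹ-trans (*ₗ-congʳ c₀≈0) (*ₗ-zeroˡ v))) (+ᴹ-identityˡ tail))) eq

  ⊆-from-points : ∀ {U W} → (∀ p → T (member U (vector p)) → T (member W (vector p))) → U ⊆ W
  ⊆-from-points {U} {W} h v v∈U = resp W (vector-number v tt)
    (h (number v) (resp U (≈ᴹ-sym (vector-number v tt)) v∈U))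

  -- Greedy extension of a basis from the zero space. The fuel `m` cannot run out, as a further
  -- vector would give a subspace of dimension above `n`.
  dim : ∀ U → ∃ (HasDim U)
  dim U = go n (ℕ.m≤n+m n 0) (λ v t → resp U (≈ᴹ-sym (zeroSpace⇒≈0 t)) (0-mem U)) zero-dim
    where
    go : ∀ m {W s} → n ≤ s + m → W ⊆ U → HasDim W s → ∃ (HasDim U)
    go m {W} {s} n≤ W⊆U dimW with any? (λ p → T? (member U (vector p)) ×-dec ¬? (T? (member W (vector p))))
    ... | no none = s , proj₁ dimW , record
      { inside      = λ i → W⊆U _ (IsBasis.inside (proj₂ dimW) i)
      ; independent = IsBasis.independent (proj₂ dimW)
      ; spanning    = λ v v∈U → IsBasis.spanning (proj₂ dimW) v (U⊆W v v∈U)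
      }
      where
      U⊆W : U ⊆ W
      U⊆W = ⊆-from-points {U} {W} λ p p∈U → decidable-stable (T? (member W (vector p))) λ p∉W → none (p , p∈U , p∉W)
    go zero {W} {s} n≤ W⊆U dimW | yes (p , p∈U , p∉W) = contradiction
      (dim-mono {adjoin W (vector p)} {whole} (λ _ _ → tt) (adjoin-dim W (vector p) dimW p∉W) dimM)
      (ℕ.<⇒≱ (s≤s (subst (n ≤_) (ℕ.+-identityʳ s) n≤)))
    go (suc m) {W} {s} n≤ W⊆U dimW | yes (p , p∈U , p∉W) = go m (subst (n ≤_) (ℕ.+-suc s m) n≤)
      (adjoin-least W (vector p) {U} W⊆U p∈U) (adjoin-dim W (vector p) dimW p∉W)

  pointed : Pointed subspaces
  pointed = record
    { N       = q ℕ.^ n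
    ; _∈_     = λ p U → T (member U (vector p))
    ; _∈?_    = λ p U → T? (member U (vector p))
    ; ≼⇒⊆     = λ U⊆W → U⊆W _
    ; ⊆⇒≼     = λ {U} {W} → ⊆-from-points {U} {W}
    ; ⊥       = zeroSpace
    ; ⊤       = whole
    ; ⊥-least = λ {U} v t → resp U (≈ᴹ-sym (zeroSpace⇒≈0 t)) (0-mem U)
    ; ⊤-great = λ _ _ → tt
    ; _▹_     = λ U p → adjoin U (vector p)
    ; ∈-▹     = λ {U} {p} → ∈-adjoin U (vector p)
    ; ≼-▹     = λ {U} {p} → ⊆-adjoin U (vector p)
    ; ▹-least = λ {U} {p} {W} → adjoin-least U (vector p) {W}
    ; rk      = λ U → proj₁ (dim U)
    ; rk-⊥    = dim-unique {zeroSpace} (proj₂ (dim zeroSpace)) zero-dim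
    ; rk-⊤    = dim-unique {whole} (proj₂ (dim whole)) dimM
    ; rk-▹    = λ {U} {p} p∉U → dim-unique {adjoin U (vector p)}
        (proj₂ (dim (adjoin U (vector p)))) (adjoin-dim U (vector p) (proj₂ (dim U)) p∉U)
    ; κ       = q ℕ.^_
    ; κ-mono  = ^-mono
    ; size    = λ U → size-dim (proj₂ (dim U))
    }

  -- Orthogonality and the count of copoints.

  coord : Carrierᴹ → Fin n → Scalar
  coord v = Numbering.coords dimM v tt

  coord-unique : ∀ {v} {c} → v ≈ᴹ combination c (proj₁ dimM) → ∀ i → coord v i ≈F c i
  coord-unique = Numbering.coords-unique dimM tt

  coord-spans : ∀ v → v ≈ᴹ combination (coord v) (proj₁ dimM)
  coord-spans v = proj₂ (IsBasis.spanning (proj₂ dimM) v tt)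

  -- A nondegenerate symmetric form identifies V with its dual, so that
  -- vectors also serve as copoints.
  ⟪_∙_⟫ : Carrierᴹ → Carrierᴹ → Scalar
  ⟪ v ∙ w ⟫ = ΣF.sum λ j → coord v j *F coord w j

  ⟨⟩-sym : ∀ v w → ⟪ v ∙ w ⟫ ≈F ⟪ w ∙ v ⟫
  ⟨⟩-sym v w = ΣF.sum-cong-≋ λ j → *F-comm (coord v j) (coord w j)

  ⟨⟩-congˡ : ∀ v {w w′} → w ≈ᴹ w′ → ⟪ v ∙ w ⟫ ≈F ⟪ v ∙ w′ ⟫
  ⟨⟩-congˡ v {w} {w′} w≈w′ = ΣF.sum-cong-≋ λ j → *F-congˡ (coord-unique (≈ᴹ-trans w≈w′ (coord-spans w′)) j)

  ⟨⟩-+ : ∀ v w w′ → ⟪ v ∙ w +ᴹ w′ ⟫ ≈F ⟪ v ∙ w ⟫ +F ⟪ v ∙ w′ ⟫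
  ⟨⟩-+ v w w′ = ≈F-trans
    (ΣF.sum-cong-≋ λ j → ≈F-trans
      (*F-congˡ (coord-unique (≈ᴹ-trans (+ᴹ-cong (coord-spans w) (coord-spans w′))
        (≈ᴹ-sym (combination-+ (proj₁ dimM) (coord w) (coord w′)))) j))
      (*F-distribˡ (coord v j) (coord w j) (coord w′ j)))
    (ΣF.∑-distrib-+ (λ j → coord v j *F coord w j) (λ j → coord v j *F coord w′ j))

  ⟨⟩-* : ∀ v a w → ⟪ v ∙ a *ₗ w ⟫ ≈F a *F ⟪ v ∙ w ⟫
  ⟨⟩-* v a w = ≈F-trans
    (ΣF.sum-cong-≋ λ j → ≈F-trans
      (*F-congˡ (coord-unique (≈ᴹ-trans (*ₗ-congˡ (coord-spans w)) (≈ᴹ-sym (combination-* (proj₁ dimM) a (coord w)))) j))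
      (x∙yz≈y∙xz (coord v j) a (coord w j)))
    (≈F-sym (ΣF.*-distribˡ-sum a (λ j → coord v j *F coord w j)))

  -- Pairing with a basis vector reads off the corresponding coordinate.
  ⟨⟩-nondegenerate : ∀ v → (∀ w → ⟪ v ∙ w ⟫ ≈F 0F) → v ≈ᴹ 0ᴹ
  ⟨⟩-nondegenerate v v⊥ = ≈ᴹ-trans (coord-spans v) (≈ᴹ-trans
    (combination-cong (proj₁ dimM) λ i → ≈F-trans (≈F-sym (sum-unit (coord v) i)) (≈F-trans
      (ΣF.sum-cong-≋ λ j → *F-congˡ (≈F-sym (coord-unique ≈ᴹ-refl j)))
      (v⊥ (combination (unit i) (proj₁ dimM)))))
    (combination-0 (proj₁ dimM)))
    where
    unit : ∀ {m} → Fin m → Fin m → Scalar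
    unit zero    zero    = 1F
    unit zero    (suc j) = 0F
    unit (suc i) zero    = 0F
    unit (suc i) (suc j) = unit i j
    sum-0 : ∀ {m} (a : Fin m → Scalar) → ΣF.sum (λ j → a j *F 0F) ≈F 0F
    sum-0 {zero}  a = ≈F-refl
    sum-0 {suc m} a = ≈F-trans (+F-cong (*F-zeroʳ (a zero)) (sum-0 (a ∘ suc))) (+F-identityˡ 0F)
    sum-unit : ∀ {m} (a : Fin m → Scalar) i → ΣF.sum (λ j → a j *F unit i j) ≈F a i
    sum-unit a zero    = ≈F-trans (+F-cong (*F-identityʳ (a zero)) (sum-0 (a ∘ suc))) (+F-identityʳ (a zero))
    sum-unit a (suc i) = ≈F-trans (+F-cong (*F-zeroʳ (a zero)) (sum-unit (a ∘ suc) i)) (+F-identityˡ (a (suc i)))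
    combination-0 : ∀ {m} (u : Fin m → Carrierᴹ) → combination (λ _ → 0F) u ≈ᴹ 0ᴹ
    combination-0 {zero}  u = ≈ᴹ-refl
    combination-0 {suc m} u = ≈ᴹ-trans (+ᴹ-cong (*ₗ-zeroˡ (u zero)) (combination-0 (u ∘ suc))) (+ᴹ-identityˡ 0ᴹ)

  0+0 : ∀ {a b} → a ≈F 0F → b ≈F 0F → a +F b ≈F 0F
  0+0 a≈0 b≈0 = ≈F-trans (+F-cong a≈0 b≈0) (+F-identityˡ 0F)

  *0 : ∀ a {b} → b ≈F 0F → a *F b ≈F 0F
  *0 a b≈0 = ≈F-trans (*F-congˡ b≈0) (*F-zeroʳ a)

  ⟨⟩-0 : ∀ v → ⟪ v ∙ 0ᴹ ⟫ ≈F 0F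
  ⟨⟩-0 v = ≈F-trans (⟨⟩-congˡ v (≈ᴹ-sym (*ₗ-zeroˡ 0ᴹ))) (≈F-trans (⟨⟩-* v 0F 0ᴹ)
    (≈F-trans (*F-comm 0F ⟪ v ∙ 0ᴹ ⟫) (*F-zeroʳ ⟪ v ∙ 0ᴹ ⟫)))

  orthogonal? : ∀ v w → Dec (⟪ v ∙ w ⟫ ≈F 0F)
  orthogonal? v w = ⟪ v ∙ w ⟫ ≈? 0F

  kernel : Carrierᴹ → Subspace
  kernel g = record
    { member = λ w → does (orthogonal? g w)
    ; resp   = λ {v} {w} v≈w t → ∈-kernel⁺ w (≈F-trans (⟨⟩-congˡ g (≈ᴹ-sym v≈w)) (∈-kernel⁻ v t))
    ; 0-mem  = ∈-kernel⁺ 0ᴹ (⟨⟩-0 g)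
    ; +-mem  = λ {v} {w} t s → ∈-kernel⁺ (v +ᴹ w) (≈F-trans (⟨⟩-+ g v w) (0+0 (∈-kernel⁻ v t) (∈-kernel⁻ w s)))
    ; *ₗ-mem = λ c {v} t → ∈-kernel⁺ (c *ₗ v) (≈F-trans (⟨⟩-* g c v) (*0 c (∈-kernel⁻ v t)))
    }
    where
    ∈-kernel⁺ : ∀ w → ⟪ g ∙ w ⟫ ≈F 0F → T (does (orthogonal? g w))
    ∈-kernel⁺ w = does-T (orthogonal? g w)
    ∈-kernel⁻ : ∀ w → T (does (orthogonal? g w)) → ⟪ g ∙ w ⟫ ≈F 0F
    ∈-kernel⁻ w = T-does (orthogonal? g w)

  ∈-kernel⁺ : ∀ {g w} → ⟪ g ∙ w ⟫ ≈F 0F → T (member (kernel g) w)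
  ∈-kernel⁺ {g} {w} = does-T (orthogonal? g w)

  ∈-kernel⁻ : ∀ {g w} → T (member (kernel g) w) → ⟪ g ∙ w ⟫ ≈F 0F
  ∈-kernel⁻ {g} {w} = T-does (orthogonal? g w)

  kernel-sym : ∀ {g w} → T (member (kernel g) w) → T (member (kernel w) g)
  kernel-sym {g} {w} t = ∈-kernel⁺ {w} (≈F-trans (⟨⟩-sym w g) (∈-kernel⁻ {g} t))

  -- The orthogonal complement. By symmetry its closure properties are those of the kernels of the
  -- vectors of `U`.
  perp : Subspace → Subspace
  perp U = record
    { member = λ g → does (U ⊆? kernel g)
    ; resp   = λ {g} {h} g≈h t → intro h λ w w∈U → resp (kernel w) g≈h (elim g t w w∈U)
    ; 0-mem  = intro 0ᴹ λ w _ → 0-mem (kernel w)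
    ; +-mem  = λ {g} {h} t s → intro (g +ᴹ h) λ w w∈U → +-mem (kernel w) (elim g t w w∈U) (elim h s w w∈U)
    ; *ₗ-mem = λ c {g} t → intro (c *ₗ g) λ w w∈U → *ₗ-mem (kernel w) c (elim g t w w∈U)
    }
    where
    intro : ∀ g → (∀ w → T (member U w) → T (member (kernel w) g)) → T (does (U ⊆? kernel g))
    intro g h = does-T (U ⊆? kernel g) λ w w∈U → kernel-sym {w} {g} (h w w∈U)
    elim : ∀ g → T (does (U ⊆? kernel g)) → ∀ w → T (member U w) → T (member (kernel w) g)
    elim g t w w∈U = kernel-sym {g} {w} (T-does (U ⊆? kernel g) t w w∈U)

  ∈-perp⁺ : ∀ {U g} → U ⊆ kernel g → T (member (perp U) g)
  ∈-perp⁺ {U} {g} = does-T (U ⊆? kernel g)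

  ∈-perp⁻ : ∀ {U g} → T (member (perp U) g) → U ⊆ kernel g
  ∈-perp⁻ {U} {g} = T-does (U ⊆? kernel g)

  -- The shift is by `- ⟪ g ∙ w ⟫ / ⟪ g ∙ v ⟫`; thus the kernel and `v` generate the whole space.
  kernel-shift : ∀ {g v} → ¬ T (member (kernel g) v) → ∀ w → Shifted (kernel g) v w
  kernel-shift {g} {v} v∉ w = -F (⟪ g ∙ w ⟫ *F y) , ∈-kernel⁺ {g} (begin
    ⟪ g ∙ w +ᴹ s *ₗ v ⟫                             ≈⟨ ⟨⟩-+ g w (s *ₗ v) ⟩
    ⟪ g ∙ w ⟫ +F ⟪ g ∙ s *ₗ v ⟫                     ≈⟨ +F-congˡ (⟨⟩-* g s v) ⟩
    ⟪ g ∙ w ⟫ +F (-F (⟪ g ∙ w ⟫ *F y)) *F ⟪ g ∙ v ⟫ ≈⟨ +F-congˡ (-‿distribˡ-* (⟪ g ∙ w ⟫ *F y) ⟪ g ∙ v ⟫) ⟨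
    ⟪ g ∙ w ⟫ +F (-F (⟪ g ∙ w ⟫ *F y *F ⟪ g ∙ v ⟫)) ≈⟨ +F-congˡ (-F-cong (≈F-trans (*F-assoc ⟪ g ∙ w ⟫ y ⟪ g ∙ v ⟫)
                                                          (≈F-trans (*F-congˡ y*) (*F-identityʳ ⟪ g ∙ w ⟫)))) ⟩
    ⟪ g ∙ w ⟫ +F (-F ⟪ g ∙ w ⟫)                     ≈⟨ -F-inverseʳ ⟪ g ∙ w ⟫ ⟩
    0F                                              ∎)
    where
    open SetoidReasoning F-setoid
    y = proj₁ (inverse (λ eq → v∉ (∈-kernel⁺ {g} eq)))
    y* = proj₂ (inverse (λ eq → v∉ (∈-kernel⁺ {g} eq)))
    s = -F (⟪ g ∙ w ⟫ *F y)

  open Pointed pointed using (rk; rk-mono; rk-▹-≤; rk-▹; rk-⊥; rk-⊤; _▹_; outside; module Chain)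

  -- One further linear condition cuts `perp (U ▹ p)` out of `perp U`. Any `g₀` violating it
  -- generates, together with `perp (U ▹ p)`, all of `perp U`.
  rk-perp-▹ : ∀ U p → rk (perp U) ≤ suc (rk (perp (U ▹ p)))
  rk-perp-▹ U p = cases (perp U ⊆? perp (U ▹ p))
    where
    v = vector p
    cases : Dec (perp U ⊆ perp (U ▹ p)) → rk (perp U) ≤ suc (rk (perp (U ▹ p)))
    cases (yes ⊆U) = ℕ.≤-trans (rk-mono {perp U} {perp (U ▹ p)} ⊆U) (ℕ.n≤1+n _)
    cases (no ⊈U)  = through (outside {perp U} {perp (U ▹ p)} ⊈U)
      where
      through : (∃ λ g → T (member (perp U) (vector g)) × ¬ T (member (perp (U ▹ p)) (vector g))) →
        rk (perp U) ≤ suc (rk (perp (U ▹ p)))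
      through (g₀ , g₀∈ , g₀∉) =
        ℕ.≤-trans (rk-mono {perp U} {perp (U ▹ p) ▹ g₀} ⊆▹) (rk-▹-≤ (perp (U ▹ p)) g₀)
        where
        v∉ : ¬ T (member (kernel v) (vector g₀))
        v∉ t = g₀∉ (∈-perp⁺ {U ▹ p} {vector g₀}
          (adjoin-least U v {kernel (vector g₀)} (∈-perp⁻ {U} {vector g₀} g₀∈) (kernel-sym {v} t)))
        ⊆▹ : perp U ⊆ (perp (U ▹ p) ▹ g₀)
        ⊆▹ g g∈ = let (s , t) = kernel-shift {v} v∉ g in
          ∈-adjoin⁺ (perp (U ▹ p)) (vector g₀) (s , ∈-perp⁺ {U ▹ p}
            (adjoin-least U v {kernel (g +ᴹ s *ₗ vector g₀)}
              (∈-perp⁻ {U} {g +ᴹ s *ₗ vector g₀} (+-mem (perp U) g∈ (*ₗ-mem (perp U) s g₀∈)))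
              (kernel-sym {v} t)))

  -- Adjoining a point raises `rk U` by one and lowers `rk (perp U)` by at most one.
  rk-perp-chain : ∀ {U W} → U ⊆ W → rk (perp U) + rk U ≤ rk (perp W) + rk W
  rk-perp-chain {U} {W} = Chain.chain (λ U → rk (perp U) + rk U ≤ rk (perp W) + rk W) {W}
    (λ {U} U⊆W W⊆U → ℕ.+-mono-≤
      (rk-mono {perp U} {perp W} λ g g∈ → ∈-perp⁺ {W} λ w w∈W → ∈-perp⁻ {U} {g} g∈ w (W⊆U w w∈W))
      (rk-mono {U} {W} U⊆W))
    (λ {U} {p} _ _ p∉U → ℕ.≤-trans (ℕ.≤-trans (ℕ.+-monoˡ-≤ (rk U) (rk-perp-▹ U p))
      (ℕ.≤-reflexive (trans (sym (ℕ.+-suc (rk (perp (U ▹ p))) (rk U))) (cong (rk (perp (U ▹ p)) +_) (sym (rk-▹ {U} p∉U)))))))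
    {U}

  -- The sum `rk (perp U) + rk U` is monotone in `U` and equals `n` at both the zero space and the
  -- whole space, the latter by nondegeneracy.
  rk-perp : ∀ U → rk (perp U) ≡ n ∸ rk U
  rk-perp U = trans (sym (ℕ.m+n∸n≡m (rk (perp U)) (rk U))) (cong (_∸ rk U) (ℕ.≤-antisym
    (ℕ.≤-trans (rk-perp-chain {U} {whole} λ _ _ → tt) (ℕ.≤-reflexive (cong₂ _+_ perp-whole rk-⊤)))
    (ℕ.≤-trans (ℕ.≤-reflexive (sym (trans (cong₂ _+_ perp-zero rk-⊥) (ℕ.+-identityʳ n))))
      (rk-perp-chain {zeroSpace} {U} λ w w≈0 → resp U (≈ᴹ-sym (zeroSpace⇒≈0 w≈0)) (0-mem U)))))
    where
    perp-whole : rk (perp whole) ≡ 0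
    perp-whole = ℕ.n≤0⇒n≡0 (subst (rk (perp whole) ≤_) rk-⊥ (rk-mono {perp whole} {zeroSpace} λ g g∈ →
      does-T (≈0? g) (⟨⟩-nondegenerate g λ w → ∈-kernel⁻ {g} (∈-perp⁻ {whole} {g} g∈ w tt))))
    perp-zero : rk (perp zeroSpace) ≡ n
    perp-zero = ℕ.≤-antisym (subst (rk (perp zeroSpace) ≤_) rk-⊤ (rk-mono {perp zeroSpace} {whole} λ _ _ → tt))
      (subst (_≤ rk (perp zeroSpace)) rk-⊤ (rk-mono {whole} {perp zeroSpace} λ g _ →
        ∈-perp⁺ {zeroSpace} λ w w≈0 → ∈-kernel⁺ {g} (≈F-trans (⟨⟩-congˡ g (zeroSpace⇒≈0 w≈0)) (⟨⟩-0 g))))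

  meet : Subspace → Subspace → Subspace
  meet U W = record
    { member = λ v → member U v ∧ member W v
    ; resp   = λ {v} {w} v≈w t → intro w (resp U v≈w (proj₁ (elim v t)) , resp W v≈w (proj₂ (elim v t)))
    ; 0-mem  = intro 0ᴹ (0-mem U , 0-mem W)
    ; +-mem  = λ {v} {w} t s → intro (v +ᴹ w)
        (+-mem U (proj₁ (elim v t)) (proj₁ (elim w s)) , +-mem W (proj₂ (elim v t)) (proj₂ (elim w s)))
    ; *ₗ-mem = λ c {v} t → intro (c *ₗ v) (*ₗ-mem U c (proj₁ (elim v t)) , *ₗ-mem W c (proj₂ (elim v t)))
    }
    where
    intro : ∀ v → T (member U v) × T (member W v) → T (member U v ∧ member W v)
    intro v = Equivalence.from (T-∧ {member U v})
    elim : ∀ v → T (member U v ∧ member W v) → T (member U v) × T (member W v)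
    elim v = Equivalence.to (T-∧ {member U v})

  copointed : Copointed pointed
  copointed = record
    { hasRank    = λ U → proj₂ (dim U)
    ; rk-unique  = λ {U} dimU → dim-unique {U} (proj₂ (dim U)) dimU
    ; _∩_        = meet
    ; ∩-≼ˡ       = λ {U} v t → proj₁ (Equivalence.to (T-∧ {member U v}) t)
    ; ∩-≼ʳ       = λ {U} v t → proj₂ (Equivalence.to (T-∧ {member U v}) t)
    ; ∩-greatest = λ {U} X⊆U X⊆W v t → Equivalence.from (T-∧ {member U v}) (X⊆U v t , X⊆W v t)
    ; modular    = λ {U} {W} {p} p∈U U⊆ v v∈U → let (s , t) = ∈-adjoin⁻ W (vector p) (U⊆ v v∈U) in
        ∈-adjoin⁺ (meet U W) (vector p) (s ,
          Equivalence.from (T-∧ {member U (v +ᴹ s *ₗ vector p)}) (+-mem U v∈U (*ₗ-mem U s p∈U) , t))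
    ; N′         = q ℕ.^ n
    ; hyp        = kernel ∘ vector
    ; hyp-▹      = λ {g} {p} p∉ v _ → ∈-adjoin⁺ (kernel (vector g)) (vector p) (kernel-shift {vector g} p∉ v)
    -- By the definition of `perp`, the copoints above `U` are the vectors of `perp U`.
    ; cosize     = λ U → trans (size-dim (proj₂ (dim (perp U)))) (cong (q ℕ.^_) (rk-perp U))
    }

-- The theorem for sets and vector spaces alike.

copointed : (V : Space) → ∃ λ (X : Pointed (geometry V)) → Copointed X
copointed (finiteSet A n A↔Fin) = _ , SetGeometry.copointed A n A↔Fin
copointed (vectorSpace F q F↔Fin M n dimM) = _ , VectorGeometry.copointed F q F↔Fin M n dimM

theorem6p6 :
  (V : Space) →
  let open Degree (geometry V)
      n = rkV in
  (k : ℕ) → k ≤ n →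
  (I J : Sub) → I ≼ J →
  (i r : ℕ) → HasRank I i → HasRank J r →
  let j = n ∸ r in
  SetHasDegree (ℱ? k I J)
    (if does ((k <? i) ⊎-dec (n ∸ k <? j))
     then ⊥₋
     else [ (i + j) ⊓ k ⊓ (n ∸ k) ])
theorem6p6 V = DegreeTheorem.degree (proj₂ (copointed V))
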